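{- Let $s\ge 1$ and $k\ge 2$ be integers and let $u=(u_1,\dots,u_{k-1})$ be a $(k-1)$-tuple of positive integers with $\gcd(u_i,u_j)=1$ for all $1\le i\neq j\le k-1$. Then the probability that $s$ positive integers $a_1,\dots,a_s$ are $k$-wise relatively prime and are $i$-wise relatively prime to $u_i$ for $i=1,2,\dots,k-1$ exists and equals $$\lim_{n\to\infty}\frac{Q_{s,k}^{(u)}(n)}{n^s}=A_{s,k}\prod_{i=1}^{k-1}f_{s,k,i}(u_i),$$ where $$A_{s,k}=\prod_{p}\left[\left(1-\frac1p\right)^{s-k+1}\sum_{m=0}^{k-1}\binom{s}{m}\left(1-\frac1p\right)^{k-1-m}\frac{1}{p^m}\right]$$ (product over all primes $p$) and $$f_{s,k,i}(u_i)=\prod_{p\mid u_i}\left(1-\frac{\sum_{m=i}^{k-1}\binom{s}{m}(p-1)^{k-1-m}}{\sum_{m=0}^{k-1}\binom{s}{m}(p-1)^{k-1-m}}\right)$$ (product over the primes $p$ dividing $u_i$). In particular, taking $u_1=u_2=\cdots=u_{k-1}=1$, the probability that $s$ positive integers are $k$-wise relatively prime is $A_{s,k}$.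
   Context: Positive integers $a_1,\dots,a_s$ are called $k$-wise relatively prime if for any $k$ of them (any $k$ distinct indices) the greatest common divisor of those $k$ integers is $1$ (a vacuous condition if $k>s$). They are called $i$-wise relatively prime to a positive integer $a$ if the gcd of any $i$ of them (any $i$ distinct indices) is relatively prime to $a$ (vacuous if $i>s$). For a $(k-1)$-tuple of positive integers $u=(u_1,\dots,u_{k-1})$, $Q_{s,k}^{(u)}(n)$ denotes the number of $s$-tuples $(a_1,\dots,a_s)$ of integers with $1\le a_1,\dots,a_s\le n$ such that $a_1,\dots,a_s$ are $k$-wise relatively prime and are $i$-wise relatively prime to $u_i$ for each $i=1,2,\dots,k-1$. The "probability" that $s$ positive integers have a property means the limit as $n\to\infty$ of the proportion of $s$-tuples in $\{1,\dots,n\}^s$ having it. Convention: $\binom{a}{b}=0$ if $b>a\ge 0$. -}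

module Defs where

open import Data.Fin.Base using (Fin; toℕ)
open import Data.Fin.Subset using (Subset; inside; outside) renaming (∣_∣ to card)
open import Data.Fin.Subset.Properties using (anySubset?)
open import Data.Fin.Properties using (all?)
open import Data.Integer.Base as ℤ using (ℤ; +_; -[1+_])
open import Data.List.Base
  using (List; []; _∷_; map; foldr; filter; length; upTo; applyUpTo; tabulate; cartesianProductWith)
open import Data.Nat.Base as ℕ using (ℕ; zero; suc; _∸_; NonTrivial)
open import Data.Nat.Combinatorics using (_C_)
open import Data.Nat.Coprimality using (Coprime; coprime?; 1-coprimeTo)
open import Data.Nat.Divisibility using (_∣?_)
open import Data.Nat.GCD using (gcd)
open import Data.Nat.ListAction using (sum)
open import Data.Nat.Primality using (Prime; prime?; prime⇒nonTrivial)
import Data.Nat.Properties as ℕ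
open import Data.Product.Base using (_×_; _,_; proj₁; proj₂; ∃-syntax)
open import Data.Rational.Base
  using (ℚ; 0ℚ; 1ℚ; ½; _/_; 1/_; _+_; _-_; _*_; -_; _≤_; _<_; *<*; ∣_∣;
         NonZero; Positive; positive; >-nonZero; +-*-rawSemiring)
import Data.Rational.Properties as ℚ
open import Data.Rational.Solver using (module +-*-Solver)
open import Data.Sum.Base using (_⊎_; inj₁; inj₂)
open import Data.Vec.Base using (Vec; []; _∷_)
import Algebra.Definitions.RawSemiring as RawSemiringDefs
open import Function.Base using (_∘_)
open import Relation.Binary.PropositionalEquality
  using (_≡_; refl; sym; trans; cong; subst)
open import Relation.Nullary.Decidable using (Dec; yes; no; ¬?; _×-dec_; _→-dec_; decidable-stable)
open import Relation.Unary using (Pred; Decidable)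
open import Level using (0ℓ)

open RawSemiringDefs +-*-rawSemiring public using (_^_)

-- Reals are Cauchy sequences of rationals.  Equality of reals is not `_≡_`:
-- a limit in the sense of `_⟶_` below is unique only up to equivalence of
-- Cauchy sequences.

IsCauchy : (ℕ → ℚ) → Set
IsCauchy x = ∀ (ε : ℚ) → 0ℚ < ε →
  ∃[ N ] (∀ m n → N ℕ.≤ m → N ℕ.≤ n → ∣ x m - x n ∣ < ε)

record ℝ : Set where
  constructor mkℝ
  field
    seq    : ℕ → ℚ
    cauchy : IsCauchy seq

open ℝ public

private
  open ℚ.≤-Reasoning

  swap₄ : ∀ a b c d → (a - b) - (c - d) ≡ (a - c) + - (b - d)
  swap₄ = solve 4 (λ a b c d →
      (a :- b) :- (c :- d) := (a :- c) :+ :- (b :- d)) refl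
    where open +-*-Solver

  half+half : ∀ ε → ½ * ε + ½ * ε ≡ ε
  half+half ε = trans (sym (ℚ.*-distribʳ-+ ε ½ ½)) (ℚ.*-identityˡ ε)

  0<½* : ∀ {ε} → 0ℚ < ε → 0ℚ < ½ * ε
  0<½* {ε} 0<ε = subst (_< ½ * ε) (ℚ.*-zeroʳ ½) (ℚ.*-monoʳ-<-pos ½ 0<ε)

  ∣∣-contract : ∀ p q → ∣ ∣ p ∣ - ∣ q ∣ ∣ ≤ ∣ p - q ∣
  ∣∣-contract p q = go (ℚ.∣p∣≡p∨∣p∣≡-p (∣ p ∣ - ∣ q ∣))
    where
    cancel : ∀ a b → (a - b) + b ≡ a
    cancel = solve 2 (λ a b → (a :- b) :+ b := a) refl
      where open +-*-Solver

    cancel′ : ∀ a b → (a + b) - b ≡ a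
    cancel′ = solve 2 (λ a b → (a :+ b) :- b := a) refl
      where open +-*-Solver

    flip- : ∀ a b → - (a - b) ≡ b - a
    flip- = solve 2 (λ a b → :- (a :- b) := b :- a) refl
      where open +-*-Solver

    upper : ∀ a b → ∣ a ∣ - ∣ b ∣ ≤ ∣ a - b ∣
    upper a b = begin
      ∣ a ∣ - ∣ b ∣                 ≡⟨ cong (λ c → ∣ c ∣ - ∣ b ∣) (sym (cancel a b)) ⟩
      ∣ (a - b) + b ∣ - ∣ b ∣       ≤⟨ ℚ.+-monoˡ-≤ (- ∣ b ∣) (ℚ.∣p+q∣≤∣p∣+∣q∣ (a - b) b) ⟩
      (∣ a - b ∣ + ∣ b ∣) - ∣ b ∣   ≡⟨ cancel′ ∣ a - b ∣ ∣ b ∣ ⟩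
      ∣ a - b ∣                     ∎

    go : _ ⊎ _ → ∣ ∣ p ∣ - ∣ q ∣ ∣ ≤ ∣ p - q ∣
    go (inj₁ eq) = subst (_≤ ∣ p - q ∣) (sym eq) (upper p q)
    go (inj₂ eq) = begin
      ∣ ∣ p ∣ - ∣ q ∣ ∣   ≡⟨ eq ⟩
      - (∣ p ∣ - ∣ q ∣)   ≡⟨ flip- ∣ p ∣ ∣ q ∣ ⟩
      ∣ q ∣ - ∣ p ∣       ≤⟨ upper q p ⟩
      ∣ q - p ∣           ≡⟨ cong ∣_∣ (sym (flip- p q)) ⟩
      ∣ - (p - q) ∣       ≡⟨ ℚ.∣-p∣≡∣p∣ (p - q) ⟩
      ∣ p - q ∣           ∎

  Bound : (ℕ → ℚ) → Set
  Bound x = ∃[ B ] ∃[ N ] (0ℚ < B × (∀ n → N ℕ.≤ n → ∣ x n ∣ ≤ B))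

  bounded : ∀ {x} → IsCauchy x → Bound x
  bounded {x} cx = ∣ x N ∣ + 1ℚ , N , 0<B , bound
    where
    N = proj₁ (cx 1ℚ (ℚ.positive⁻¹ 1ℚ))

    0<B : 0ℚ < ∣ x N ∣ + 1ℚ
    0<B = ℚ.+-mono-≤-< (ℚ.0≤∣p∣ (x N)) (ℚ.positive⁻¹ 1ℚ)

    split : ∀ a b → a ≡ b + (a - b)
    split = solve 2 (λ a b → a := b :+ (a :- b)) refl
      where open +-*-Solver

    bound : ∀ n → N ℕ.≤ n → ∣ x n ∣ ≤ ∣ x N ∣ + 1ℚ
    bound n N≤n = begin
      ∣ x n ∣                 ≡⟨ cong ∣_∣ (split (x n) (x N)) ⟩
      ∣ x N + (x n - x N) ∣   ≤⟨ ℚ.∣p+q∣≤∣p∣+∣q∣ (x N) (x n - x N) ⟩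
      ∣ x N ∣ + ∣ x n - x N ∣ ≤⟨ ℚ.+-monoʳ-≤ ∣ x N ∣ (ℚ.<⇒≤
                                  (proj₂ (cx 1ℚ (ℚ.positive⁻¹ 1ℚ)) n N N≤n ℕ.≤-refl)) ⟩
      ∣ x N ∣ + 1ℚ            ∎

  const-cauchy : ∀ q → IsCauchy (λ _ → q)
  const-cauchy q ε 0<ε = 0 , λ _ _ _ _ →
    subst (λ r → ∣ r ∣ < ε) (sym (ℚ.+-inverseʳ q)) 0<ε

  sub-cauchy : ∀ {x y} → IsCauchy x → IsCauchy y → IsCauchy (λ n → x n - y n)
  sub-cauchy {x} {y} cx cy ε 0<ε = M ℕ.⊔ N , close
    where
    M = proj₁ (cx (½ * ε) (0<½* 0<ε))
    N = proj₁ (cy (½ * ε) (0<½* 0<ε))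

    close : ∀ m n → M ℕ.⊔ N ℕ.≤ m → M ℕ.⊔ N ℕ.≤ n → ∣ (x m - y m) - (x n - y n) ∣ < ε
    close m n ≤m ≤n = begin-strict
      ∣ (x m - y m) - (x n - y n) ∣   ≡⟨ cong ∣_∣ (swap₄ (x m) (y m) (x n) (y n)) ⟩
      ∣ (x m - x n) - (y m - y n) ∣   ≤⟨ ℚ.∣p-q∣≤∣p∣+∣q∣ (x m - x n) (y m - y n) ⟩
      ∣ x m - x n ∣ + ∣ y m - y n ∣   <⟨ ℚ.+-mono-<
        (proj₂ (cx (½ * ε) (0<½* 0<ε)) m n (ℕ.m⊔n≤o⇒m≤o M N ≤m) (ℕ.m⊔n≤o⇒m≤o M N ≤n))
        (proj₂ (cy (½ * ε) (0<½* 0<ε)) m n (ℕ.m⊔n≤o⇒n≤o M N ≤m) (ℕ.m⊔n≤o⇒n≤o M N ≤n)) ⟩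
      ½ * ε + ½ * ε                   ≡⟨ half+half ε ⟩
      ε                               ∎

  abs-cauchy : ∀ {x} → IsCauchy x → IsCauchy (λ n → ∣ x n ∣)
  abs-cauchy {x} cx ε 0<ε = proj₁ (cx ε 0<ε) , λ m n ≤m ≤n →
    ℚ.≤-<-trans (∣∣-contract (x m) (x n)) (proj₂ (cx ε 0<ε) m n ≤m ≤n)

  mul-cauchy : ∀ {x y} → IsCauchy x → IsCauchy y → IsCauchy (λ n → x n * y n)
  mul-cauchy {x} {y} cx cy ε 0<ε = go (bounded {x} cx) (bounded {y} cy)
   where
   go : Bound x → Bound y → _
   go (B , N₁ , 0<B , x≤B) (D , N₂ , 0<D , y≤D) = K , close
    where
    instance
      B+D>0 : Positive (B + D)
      B+D>0 = positive (ℚ.+-mono-< 0<B 0<D)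

      B>0 : Positive B
      B>0 = positive 0<B

      D>0 : Positive D
      D>0 = positive 0<D

      B+D≢0 : NonZero (B + D)
      B+D≢0 = ℚ.pos⇒nonZero (B + D)

      ε>0 : Positive ε
      ε>0 = positive 0<ε

    δ = 1/ (B + D) * ε

    0<δ : 0ℚ < δ
    0<δ = ℚ.positive⁻¹ δ {{ℚ.pos*pos⇒pos (1/ (B + D)) {{ℚ.1/pos⇒pos (B + D)}} ε}}

    N₃ = proj₁ (cx δ 0<δ)
    N₄ = proj₁ (cy δ 0<δ)
    K  = (N₁ ℕ.⊔ N₂) ℕ.⊔ (N₃ ℕ.⊔ N₄)

    split : ∀ a b c d → a * b - c * d ≡ a * (b - d) + (a - c) * d
    split = solve 4 (λ a b c d → a :* b :- c :* d := a :* (b :- d) :+ (a :- c) :* d) refl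
      where open +-*-Solver

    ≤₁ : ∀ {n} → K ℕ.≤ n → N₁ ℕ.≤ n
    ≤₁ = ℕ.m⊔n≤o⇒m≤o N₁ N₂ ∘ ℕ.m⊔n≤o⇒m≤o (N₁ ℕ.⊔ N₂) (N₃ ℕ.⊔ N₄)
    ≤₂ : ∀ {n} → K ℕ.≤ n → N₂ ℕ.≤ n
    ≤₂ = ℕ.m⊔n≤o⇒n≤o N₁ N₂ ∘ ℕ.m⊔n≤o⇒m≤o (N₁ ℕ.⊔ N₂) (N₃ ℕ.⊔ N₄)
    ≤₃ : ∀ {n} → K ℕ.≤ n → N₃ ℕ.≤ n
    ≤₃ = ℕ.m⊔n≤o⇒m≤o N₃ N₄ ∘ ℕ.m⊔n≤o⇒n≤o (N₁ ℕ.⊔ N₂) (N₃ ℕ.⊔ N₄)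
    ≤₄ : ∀ {n} → K ℕ.≤ n → N₄ ℕ.≤ n
    ≤₄ = ℕ.m⊔n≤o⇒n≤o N₃ N₄ ∘ ℕ.m⊔n≤o⇒n≤o (N₁ ℕ.⊔ N₂) (N₃ ℕ.⊔ N₄)

    *-bound : ∀ {a b} p q → ∣ p ∣ ≤ a → ∣ q ∣ < b → Positive a → ∣ p * q ∣ < a * b
    *-bound {a} {b} p q p≤a q<b a>0 = begin-strict
      ∣ p * q ∣       ≡⟨ ℚ.∣p*q∣≡∣p∣*∣q∣ p q ⟩
      ∣ p ∣ * ∣ q ∣   ≤⟨ ℚ.*-monoʳ-≤-nonNeg ∣ q ∣ {{ℚ.∣-∣-nonNeg q}} p≤a ⟩
      a * ∣ q ∣       <⟨ ℚ.*-monoʳ-<-pos a {{a>0}} q<b ⟩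
      a * b           ∎

    close : ∀ m n → K ℕ.≤ m → K ℕ.≤ n → ∣ x m * y m - x n * y n ∣ < ε
    close m n ≤m ≤n = begin-strict
      ∣ x m * y m - x n * y n ∣
        ≡⟨ cong ∣_∣ (split (x m) (y m) (x n) (y n)) ⟩
      ∣ x m * (y m - y n) + (x m - x n) * y n ∣
        ≤⟨ ℚ.∣p+q∣≤∣p∣+∣q∣ (x m * (y m - y n)) ((x m - x n) * y n) ⟩
      ∣ x m * (y m - y n) ∣ + ∣ (x m - x n) * y n ∣
        ≡⟨ cong (λ r → ∣ x m * (y m - y n) ∣ + ∣ r ∣) (ℚ.*-comm (x m - x n) (y n)) ⟩
      ∣ x m * (y m - y n) ∣ + ∣ y n * (x m - x n) ∣
        <⟨ ℚ.+-mono-<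
             (*-bound (x m) (y m - y n) (x≤B m (≤₁ ≤m)) (proj₂ (cy δ 0<δ) m n (≤₄ ≤m) (≤₄ ≤n)) B>0)
             (*-bound (y n) (x m - x n) (y≤D n (≤₂ ≤n)) (proj₂ (cx δ 0<δ) m n (≤₃ ≤m) (≤₃ ≤n)) D>0) ⟩
      B * δ + D * δ
        ≡⟨ sym (ℚ.*-distribʳ-+ δ B D) ⟩
      (B + D) * (1/ (B + D) * ε)
        ≡⟨ sym (ℚ.*-assoc (B + D) (1/ (B + D)) ε) ⟩
      (B + D) * 1/ (B + D) * ε
        ≡⟨ cong (_* ε) (ℚ.*-inverseʳ (B + D)) ⟩
      1ℚ * ε
        ≡⟨ ℚ.*-identityˡ ε ⟩
      ε ∎

fromℚ : ℚ → ℝ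
fromℚ q = mkℝ (λ _ → q) (const-cauchy q)

infixl 6 _-ᴿ_
_-ᴿ_ : ℝ → ℝ → ℝ
x -ᴿ y = mkℝ (λ n → seq x n - seq y n) (sub-cauchy {seq x} {seq y} (cauchy x) (cauchy y))

infixl 7 _*ᴿ_
_*ᴿ_ : ℝ → ℝ → ℝ
x *ᴿ y = mkℝ (λ n → seq x n * seq y n) (mul-cauchy {seq x} {seq y} (cauchy x) (cauchy y))

∣_∣ᴿ : ℝ → ℝ
∣ x ∣ᴿ = mkℝ (λ n → ∣ seq x n ∣) (abs-cauchy {seq x} (cauchy x))

-- A positive gap is required: termwise `_<_` would not respect equality
-- of reals.
infix 4 _<ᴿ_
_<ᴿ_ : ℝ → ℝ → Set
x <ᴿ y = ∃[ δ ] (0ℚ < δ × ∃[ N ] (∀ n → N ℕ.≤ n → seq x n + δ ≤ seq y n))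

-- Rational ε suffice, the rationals being dense.
infix 4 _⟶_
_⟶_ : (ℕ → ℚ) → ℝ → Set
x ⟶ L = ∀ (ε : ℚ) → 0ℚ < ε →
  ∃[ N ] (∀ n → N ℕ.≤ n → ∣ fromℚ (x n) -ᴿ L ∣ᴿ <ᴿ fromℚ ε)

private variable s : ℕ

-- The gcd of the aⱼ with j ∈ I.  The empty gcd is 0, but only nonempty I
-- are used below.
gcdOver : Subset s → Vec ℕ s → ℕ
gcdOver []            []       = 0
gcdOver (inside  ∷ I) (a ∷ as) = gcd a (gcdOver I as)
gcdOver (outside ∷ I) (a ∷ as) = gcdOver I as

WiseCoprime : ℕ → Pred (Vec ℕ s) 0ℓ
WiseCoprime {s} k a = ∀ (I : Subset s) → card I ≡ k → gcdOver I a ≡ 1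

WiseCoprimeTo : ℕ → ℕ → Pred (Vec ℕ s) 0ℓ
WiseCoprimeTo {s} i u a = ∀ (I : Subset s) → card I ≡ i → Coprime (gcdOver I a) u

-- The index i : Fin (k ∸ 1) is 0-based: u i is u_{i+1}.
Admissible : (k : ℕ) → (Fin (k ∸ 1) → ℕ) → Pred (Vec ℕ s) 0ℓ
Admissible k u a = WiseCoprime k a × (∀ i → WiseCoprimeTo (suc (toℕ i)) (u i) a)

private
  allSubset? : {P : Pred (Subset s) 0ℓ} → Decidable P → Dec (∀ I → P I)
  allSubset? P? with anySubset? (¬? ∘ P?)
  ... | yes (I , ¬PI) = no λ all → ¬PI (all I)
  ... | no  ¬∃        = yes λ I → decidable-stable (P? I) λ ¬PI → ¬∃ (I , ¬PI)

wiseCoprime? : ∀ k → Decidable (WiseCoprime {s} k)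
wiseCoprime? k a = allSubset? λ I → (card I ℕ.≟ k) →-dec (gcdOver I a ℕ.≟ 1)

wiseCoprimeTo? : ∀ i u → Decidable (WiseCoprimeTo {s} i u)
wiseCoprimeTo? i u a = allSubset? λ I → (card I ℕ.≟ i) →-dec coprime? (gcdOver I a) u

admissible? : ∀ k u → Decidable (Admissible {s} k u)
admissible? k u a =
  wiseCoprime? k a ×-dec all? λ i → wiseCoprimeTo? (suc (toℕ i)) (u i) a

tuples : (s n : ℕ) → List (Vec ℕ s)
tuples zero    n = [] ∷ []
tuples (suc s) n = cartesianProductWith _∷_ (applyUpTo suc n) (tuples s n)

count : {P : Pred (Vec ℕ s) 0ℓ} → Decidable P → ℕ → ℕ
count {s} P? n = length (filter P? (tuples s n))

Q : (s k : ℕ) → (Fin (k ∸ 1) → ℕ) → ℕ → ℕ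
Q s k u = count {s} (admissible? k u)

proportion : (s c n : ℕ) → .{{ℕ.NonZero n}} → ℚ
proportion s c n = _/_ (+ c) (n ℕ.^ s) {{ℕ.m^n≢0 n s}}

-- The sequence is indexed by n ↦ suc n, since there is no proportion at 0.
HasProbability : {P : Pred (Vec ℕ s) 0ℓ} → Decidable P → ℝ → Set
HasProbability {s} P? x = (λ n → proportion s (count P? (suc n)) (suc n)) ⟶ x

[_⋯_] : ℕ → ℕ → List ℕ
[ a ⋯ b ] = applyUpTo (a ℕ.+_) (suc b ∸ a)

sumℚ productℚ : List ℚ → ℚ
sumℚ     = foldr _+_ 0ℚ
productℚ = foldr _*_ 1ℚ

infixr 8 _^ᶻ_
_^ᶻ_ : (q : ℚ) → .{{NonZero q}} → ℤ → ℚ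
q ^ᶻ (+ n)      = q ^ n
q ^ᶻ (-[1+ n ]) = (1/ q) ^ suc n

atPrime : ((p : ℕ) → .{{NonTrivial p}} → ℚ) → (p : ℕ) → Dec (Prime p) → ℚ
atPrime g p (yes pr) = g p {{prime⇒nonTrivial pr}}
atPrime g p (no  _)  = 1ℚ

∏ₚ : List ℕ → ((p : ℕ) → .{{NonTrivial p}} → ℚ) → ℚ
∏ₚ ps g = productℚ (map (λ p → atPrime g p (prime? p)) ps)

inv : (p : ℕ) → .{{NonTrivial p}} → ℚ
inv p = _/_ (+ 1) p {{ℕ.nonTrivial⇒nonZero p}}

1-inv≢0 : ∀ p → .{{_ : NonTrivial p}} → NonZero (1ℚ - inv p)
1-inv≢0 p@(suc (suc n)) = >-nonZero (begin-strict
  0ℚ            ≡⟨ sym (ℚ.+-inverseʳ (inv p)) ⟩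
  inv p - inv p <⟨ ℚ.+-monoˡ-< (- inv p) inv<1 ⟩
  1ℚ - inv p    ∎)
  where
  inv<1 : inv p < 1ℚ
  inv<1 = subst (_< 1ℚ) (sym (ℚ.normalize-coprime (1-coprimeTo p)))
    (*<* (ℤ.+<+ (ℕ.s≤s (ℕ.s≤s ℕ.z≤n))))

-- The exponent s - k + 1 is negative when s < k - 1.
factorA : (s k p : ℕ) → .{{NonTrivial p}} → ℚ
factorA s k p =
    _^ᶻ_ (1ℚ - inv p) {{1-inv≢0 p}} (+ s ℤ.- + k ℤ.+ ℤ.1ℤ)
  * sumℚ (map (λ m → (+ (s C m) / 1) * (1ℚ - inv p) ^ (k ∸ 1 ∸ m) * inv p ^ m)
              [ 0 ⋯ k ∸ 1 ])

partialA : (s k N : ℕ) → ℚ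
partialA s k N = ∏ₚ (upTo (suc N)) (factorA s k)

binomSum : (s k i p : ℕ) → ℕ
binomSum s k i p = sum (map (λ m → (s C m) ℕ.* (p ∸ 1) ℕ.^ (k ∸ 1 ∸ m)) [ i ⋯ k ∸ 1 ])

binomSum₀≢0 : ∀ s k p → .{{NonTrivial p}} → ℕ.NonZero (binomSum s k 0 p)
binomSum₀≢0 s k (suc (suc n)) = ℕ.>-nonZero (ℕ.≤-trans
  (ℕ.≤-trans (ℕ.m^n>0 (suc n) (k ∸ 1)) (ℕ.≤-reflexive (sym (ℕ.*-identityˡ _))))
  (ℕ.m≤m+n _ _))

f : (s k i u : ℕ) → ℚ
f s k i u = ∏ₚ (filter (_∣? u) (upTo (suc u)))
  λ p → 1ℚ - _/_ (+ binomSum s k i p) (binomSum s k 0 p) {{binomSum₀≢0 s k p}}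

∏f : (s k : ℕ) → (Fin (k ∸ 1) → ℕ) → ℚ
∏f s k u = productℚ (tabulate λ i → f s k (suc (toℕ i)) (u i))

-- Let hits p a be the number of entries of the tuple a that p divides.  The
-- tuple is admissible iff hits p a < τ p for every prime p, where τ p = i if p
-- divides u_i and τ p = k otherwise.
--
-- The conditions at the primes p ≤ y are asymptotically independent: expanding
-- the product over p of functions of [p ∣ a] into terms [d ∣ a] with d
-- squarefree gives the mean of that product over a ≤ n up to 2^(y+1) / n, and
-- the entries of a tuple are added one at a time.  The density obtained is a
-- finite product of binomial distribution functions.  Since τ p ≥ 2 for large
-- p, the conditions at the primes p > y fail for a proportion of at most
-- C(s, 2) ∑_{p > y} 1/p² ≤ C(s, 2) / y of the tuples.  Hence the proportion of
-- admissible tuples is an iterated limit of the partial products, which also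
-- forces these to be a Cauchy sequence.

module Submission where

open import Data.Fin.Base using (Fin; zero; suc; toℕ)
open import Data.Fin.Properties using (any?; toℕ<n) renaming (_≟_ to _≟ᶠ_)
open import Data.Fin.Subset using (Subset; inside; outside) renaming (∣_∣ to card)
open import Data.Integer.Base as ℤ using (_⊖_)
import Data.Integer.Properties as ℤ
open import Data.List.Base
  using ([]; _∷_; _++_; map; filter; length; applyUpTo; upTo; tabulate; cartesianProductWith)
open import Data.List.Properties
  using (map-++; map-∘; map-applyUpTo; applyUpTo-∷ʳ; upTo-∷ʳ; tabulate-cong)
open import Data.List.Relation.Unary.All using ([]; _∷_)
open import Data.Nat.Base as ℕ using (ℕ; zero; suc; _∸_; z≤n; s≤s)
open import Data.Nat.Combinatorics using (_C_; nCk+nC[k+1]≡[n+1]C[k+1]; nC1≡n; k>n⇒nCk≡0)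
open import Data.Nat.Divisibility
  using (_∣_; _∤_; _∣?_; divides; ∣⇒≤; >⇒∤; ∣m+n∣m⇒∣n; ∣m∣n⇒∣m+n; m∣m*n; n∣m*n; ∣-trans; ∣-refl;
         1∣_; _∣0; ∣1⇒≡1)
open import Data.Nat.GCD using (gcd; gcd[m,n]∣m; gcd[m,n]∣n; gcd-greatest)
open import Data.Nat.ListAction using (sum)
open import Data.Nat.Primality
  using (Prime; prime?; prime⇒nonZero; prime⇒nonTrivial; euclidsLemma; prime⇒irreducible;
         prime[2]; ¬prime[1])
open import Data.Nat.Primality.Factorisation using (factorise)
import Data.Nat.Properties as ℕ
open import Data.Product.Base using (∃-syntax; _×_; _,_; proj₁; proj₂)
open import Data.Rational.Base
  using (ℚ; 0ℚ; 1ℚ; ½; _/_; 1/_; _+_; _-_; _*_; -_; _≤_; _<_; ∣_∣; mkℚ; *<*; toℚᵘ; fromℚᵘ;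
         NonZero; nonNegative)
import Data.Rational.Properties as ℚ
open import Data.Rational.Solver using (module +-*-Solver)
import Data.Rational.Unnormalised.Base as ℚᵘ
import Data.Rational.Unnormalised.Properties as ℚᵘ
open import Data.Sum.Base using (_⊎_; inj₁; inj₂; [_,_]′)
open import Data.Vec.Base using (Vec; []; _∷_)
open import Data.Vec.Relation.Unary.All using (All; []; _∷_)
open import Function.Base using (_∘_)
open import Level using (0ℓ)
open import Relation.Binary.PropositionalEquality
  using (_≡_; _≢_; refl; sym; trans; cong; cong₂; subst; subst₂; module ≡-Reasoning)
open import Relation.Nullary using (¬_; contradiction)
open import Relation.Nullary.Decidable using (Dec; yes; no)
open import Relation.Unary using (Pred; Decidable)
open import Defs

open +-*-Solver using (solve; _:+_; _:*_; _:-_; :-_; _:=_; con)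

-- Rational arithmetic

-- Adding entries one at a time works because the claim is proved for all τ at once: after a first
-- entry a is fixed, the other entries face the same problem with τ p lowered by one at every p
-- dividing a. At each prime the density of that smaller problem is affine in [p ∣ a], and its mean
-- over a reproduces the recursion of the binomial distribution function.
--
-- The formulas for A and f come from writing this distribution function as (1 - 1/p)^(s - k + 1)
-- times a homogeneous polynomial in 1 - 1/p and 1/p. Scaling both variables by p turns the
-- polynomial into the integer sums in f. Since the exponent may be negative, the identities are
-- proved after multiplication by powers, which are then cancelled.
--
-- A real is a Cauchy sequence here, so A cannot even be named before its partial products are known
-- to be Cauchy. Comparing two of them with one and the same proportion settles this without any
-- estimate of the factors of A.
--
-- That τ p is well defined rests on the coprimality of the u_i: a prime divides at most one of
-- them.

ι : ℕ → ℚ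
ι n = ℤ.+ n / 1

-- 1/n, with the junk value 0 at n = 0.
ρ : ℕ → ℚ
ρ zero    = 0ℚ
ρ (suc n) = ℤ.+ 1 / suc n

fromℚᵘ-homo-+ : ∀ p q → fromℚᵘ (p ℚᵘ.+ q) ≡ fromℚᵘ p + fromℚᵘ q
fromℚᵘ-homo-+ p q = ℚ.toℚᵘ-injective (begin
  toℚᵘ (fromℚᵘ (p ℚᵘ.+ q))                    ≈⟨ ℚ.toℚᵘ-fromℚᵘ (p ℚᵘ.+ q) ⟩
  p ℚᵘ.+ q                                    ≈⟨ ℚᵘ.+-cong (ℚ.toℚᵘ-fromℚᵘ p) (ℚ.toℚᵘ-fromℚᵘ q) ⟨
  toℚᵘ (fromℚᵘ p) ℚᵘ.+ toℚᵘ (fromℚᵘ q)        ≈⟨ ℚ.toℚᵘ-homo-+ (fromℚᵘ p) (fromℚᵘ q) ⟨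
  toℚᵘ (fromℚᵘ p + fromℚᵘ q)                  ∎)
  where open ℚᵘ.≃-Reasoning

fromℚᵘ-homo-* : ∀ p q → fromℚᵘ (p ℚᵘ.* q) ≡ fromℚᵘ p * fromℚᵘ q
fromℚᵘ-homo-* p q = ℚ.toℚᵘ-injective (begin
  toℚᵘ (fromℚᵘ (p ℚᵘ.* q))                    ≈⟨ ℚ.toℚᵘ-fromℚᵘ (p ℚᵘ.* q) ⟩
  p ℚᵘ.* q                                    ≈⟨ ℚᵘ.*-cong (ℚ.toℚᵘ-fromℚᵘ p) (ℚ.toℚᵘ-fromℚᵘ q) ⟨
  toℚᵘ (fromℚᵘ p) ℚᵘ.* toℚᵘ (fromℚᵘ q)        ≈⟨ ℚ.toℚᵘ-homo-* (fromℚᵘ p) (fromℚᵘ q) ⟨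
  toℚᵘ (fromℚᵘ p * fromℚᵘ q)                  ∎)
  where open ℚᵘ.≃-Reasoning

ι-+ : ∀ m n → ι (m ℕ.+ n) ≡ ι m + ι n
ι-+ m n = trans
  (cong (_/ 1) (cong₂ ℤ._+_ (sym (ℤ.*-identityʳ (ℤ.+ m))) (sym (ℤ.*-identityʳ (ℤ.+ n)))))
  (fromℚᵘ-homo-+ (ℚᵘ.mkℚᵘ (ℤ.+ m) 0) (ℚᵘ.mkℚᵘ (ℤ.+ n) 0))

ι-* : ∀ m n → ι (m ℕ.* n) ≡ ι m * ι n
ι-* m n = trans (cong (_/ 1) (ℤ.pos-* m n))
  (fromℚᵘ-homo-* (ℚᵘ.mkℚᵘ (ℤ.+ m) 0) (ℚᵘ.mkℚᵘ (ℤ.+ n) 0))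

ι-suc : ∀ n → ι (suc n) ≡ 1ℚ + ι n
ι-suc = ι-+ 1

-- Reduces fractions to two ring atoms tied together by `ι*ρ≡1`, so that the ring solver can handle
-- them.
/≡ι*ρ : ∀ c n → .{{_ : ℕ.NonZero n}} → ℤ.+ c / n ≡ ι c * ρ n
/≡ι*ρ c (suc n) = trans
  (ℚ.fromℚᵘ-cong {ℚᵘ.mkℚᵘ (ℤ.+ c) n} {ℚᵘ.mkℚᵘ (ℤ.+ c) 0 ℚᵘ.* ℚᵘ.mkℚᵘ (ℤ.+ 1) n}
    (ℚᵘ.*≡* (cong₂ ℤ._*_ (sym (ℤ.*-identityʳ (ℤ.+ c))) (cong (λ m → ℤ.+ suc m) (ℕ.+-identityʳ n)))))
  (fromℚᵘ-homo-* (ℚᵘ.mkℚᵘ (ℤ.+ c) 0) (ℚᵘ.mkℚᵘ (ℤ.+ 1) n))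

ι*ρ≡1 : ∀ n → .{{_ : ℕ.NonZero n}} → ι n * ρ n ≡ 1ℚ
ι*ρ≡1 n@(suc n′) = trans (sym (/≡ι*ρ n n))
  (ℚ.fromℚᵘ-cong {ℚᵘ.mkℚᵘ (ℤ.+ n) n′} {ℚᵘ.mkℚᵘ (ℤ.+ 1) 0}
    (ℚᵘ.*≡* (trans (ℤ.*-identityʳ (ℤ.+ n)) (sym (ℤ.*-identityˡ (ℤ.+ n))))))

0≤ι : ∀ n → 0ℚ ≤ ι n
0≤ι n = ℚ.nonNegative⁻¹ (ι n) {{ℚ.normalize-nonNeg n 1}}

0≤ρ : ∀ n → 0ℚ ≤ ρ n
0≤ρ zero    = ℚ.≤-refl
0≤ρ (suc n) = ℚ.nonNegative⁻¹ (ρ (suc n)) {{ℚ.normalize-nonNeg 1 (suc n)}}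

0≤1 : 0ℚ ≤ 1ℚ
0≤1 = 0≤ι 1

ι-mono : ∀ {m n} → m ℕ.≤ n → ι m ≤ ι n
ι-mono {m} {n} m≤n = subst₂ _≤_ (ℚ.+-identityʳ (ι m))
  (trans (sym (ι-+ m (n ℕ.∸ m))) (cong ι (ℕ.m+[n∸m]≡n m≤n)))
  (ℚ.+-monoʳ-≤ (ι m) (0≤ι (n ℕ.∸ m)))

+-nonneg : ∀ {a b} → 0ℚ ≤ a → 0ℚ ≤ b → 0ℚ ≤ a + b
+-nonneg = ℚ.+-mono-≤

*-monoˡ : ∀ {a b} c → 0ℚ ≤ c → a ≤ b → c * a ≤ c * b
*-monoˡ c 0≤c = ℚ.*-monoˡ-≤-nonNeg c {{nonNegative 0≤c}}

*-monoʳ : ∀ {a b} c → 0ℚ ≤ c → a ≤ b → a * c ≤ b * c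
*-monoʳ c 0≤c = ℚ.*-monoʳ-≤-nonNeg c {{nonNegative 0≤c}}

*-nonneg : ∀ {a b} → 0ℚ ≤ a → 0ℚ ≤ b → 0ℚ ≤ a * b
*-nonneg {a} {b} 0≤a 0≤b = subst (_≤ a * b) (ℚ.*-zeroʳ a) (*-monoˡ a 0≤a 0≤b)

*-mono : ∀ {a b c d} → 0ℚ ≤ b → 0ℚ ≤ c → a ≤ b → c ≤ d → a * c ≤ b * d
*-mono {b = b} {c} 0≤b 0≤c a≤b c≤d = ℚ.≤-trans (*-monoʳ c 0≤c a≤b) (*-monoˡ b 0≤b c≤d)

≤-from-sub : ∀ {a b c} → 0ℚ ≤ c → a + c ≡ b → a ≤ b
≤-from-sub {a} 0≤c eq = subst₂ _≤_ (ℚ.+-identityʳ a) eq (ℚ.+-monoʳ-≤ a 0≤c)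

p≤q⇒0≤q-p : ∀ {p q} → p ≤ q → 0ℚ ≤ q - p
p≤q⇒0≤q-p {p} {q} p≤q = subst (_≤ q - p) (ℚ.+-inverseʳ p) (ℚ.+-monoˡ-≤ (- p) p≤q)

∣p∣≤q : ∀ {p q} → p ≤ q → - p ≤ q → ∣ p ∣ ≤ q
∣p∣≤q {p} p≤q -p≤q with ℚ.∣p∣≡p∨∣p∣≡-p p
... | inj₁ eq = subst (_≤ _) (sym eq) p≤q
... | inj₂ eq = subst (_≤ _) (sym eq) -p≤q

p≤∣p∣ : ∀ p → p ≤ ∣ p ∣
p≤∣p∣ p with ℚ.≤-total 0ℚ p
... | inj₁ 0≤p = ℚ.≤-reflexive (sym (ℚ.0≤p⇒∣p∣≡p 0≤p))
... | inj₂ p≤0 = ℚ.≤-trans p≤0 (ℚ.0≤∣p∣ p)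

∣-∣-comm : ∀ p q → ∣ p - q ∣ ≡ ∣ q - p ∣
∣-∣-comm p q = trans (sym (ℚ.∣-p∣≡∣p∣ (p - q)))
  (cong ∣_∣ (solve 2 (λ p q → :- (p :- q) := q :- p) refl p q))

∣-∣-triangle : ∀ p q r → ∣ p - r ∣ ≤ ∣ p - q ∣ + ∣ q - r ∣
∣-∣-triangle p q r = subst (_≤ ∣ p - q ∣ + ∣ q - r ∣)
  (cong ∣_∣ (solve 3 (λ p q r → (p :- q) :+ (q :- r) := p :- r) refl p q r))
  (ℚ.∣p+q∣≤∣p∣+∣q∣ (p - q) (q - r))

ι-^ : ∀ m n → ι (m ℕ.^ n) ≡ ι m ^ n
ι-^ m zero    = refl
ι-^ m (suc n) = trans (ι-* m (m ℕ.^ n)) (cong (ι m *_) (ι-^ m n))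

ι-cancel : ∀ n {a b} → .{{ℕ.NonZero n}} → ι n * a ≡ ι n * b → a ≡ b
ι-cancel n {a} {b} eq = trans (sym (undo a)) (trans (cong (ρ n *_) eq) (undo b))
  where
  undo : ∀ c → ρ n * (ι n * c) ≡ c
  undo c = trans (solve 3 (λ r i c → r :* (i :* c) := i :* r :* c) refl (ρ n) (ι n) c)
    (trans (cong (_* c) (ι*ρ≡1 n)) (ℚ.*-identityˡ c))

archimedean : ∀ (c : ℕ) ε → 0ℚ < ε → ∃[ N ] (∀ n → N ℕ.≤ n → .{{ℕ.NonZero n}} → ι c * ρ n ≤ ε)
archimedean c (mkℚ ℤ.-[1+ _ ] d _) (*<* ())
archimedean c (mkℚ (ℤ.+ zero) d _) (*<* (ℤ.+<+ ()))
-- Here ε = (a + 1) / D with D = d + 1. As D * ε = a + 1 ≥ 1, every n ≥ c * D satisfies c ≤ n * ε.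
archimedean c ε@(mkℚ (ℤ.+ suc a) d _) _ = c ℕ.* suc d , bound
  where
  D = suc d

  ιDε : ι D * ε ≡ ι (suc a)
  ιDε = begin
    ι D * ε                       ≡⟨ cong (ι D *_) (trans (sym (ℚ.↥p/↧p≡p ε)) (/≡ι*ρ (suc a) D)) ⟩
    ι D * (ι (suc a) * ρ D)
      ≡⟨ solve 3 (λ x y z → x :* (y :* z) := y :* (x :* z)) refl (ι D) (ι (suc a)) (ρ D) ⟩
    ι (suc a) * (ι D * ρ D)       ≡⟨ cong (ι (suc a) *_) (ι*ρ≡1 D) ⟩
    ι (suc a) * 1ℚ                ≡⟨ ℚ.*-identityʳ _ ⟩
    ι (suc a)                     ∎
    where open ≡-Reasoning

  0≤ε : 0ℚ ≤ ε
  0≤ε = ℚ.nonNegative⁻¹ ε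

  bound : ∀ n → c ℕ.* D ℕ.≤ n → .{{ℕ.NonZero n}} → ι c * ρ n ≤ ε
  bound n cD≤n = begin
    ι c * ρ n                     ≡⟨ cong (_* ρ n) (sym (ℚ.*-identityʳ (ι c))) ⟩
    ι c * 1ℚ * ρ n
      ≤⟨ *-monoʳ (ρ n) (0≤ρ n) (*-monoˡ (ι c) (0≤ι c) (ι-mono {1} {suc a} (s≤s z≤n))) ⟩
    ι c * ι (suc a) * ρ n         ≡⟨ cong (λ x → ι c * x * ρ n) (sym ιDε) ⟩
    ι c * (ι D * ε) * ρ n
      ≡⟨ solve 4 (λ c d e r → c :* (d :* e) :* r := (c :* d) :* (e :* r)) refl (ι c) (ι D) ε (ρ n) ⟩
    ι c * ι D * (ε * ρ n)         ≡⟨ cong (_* (ε * ρ n)) (sym (ι-* c D)) ⟩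
    ι (c ℕ.* D) * (ε * ρ n)
      ≤⟨ *-monoʳ (ε * ρ n) (*-nonneg 0≤ε (0≤ρ n)) (ι-mono {c ℕ.* D} {n} cD≤n) ⟩
    ι n * (ε * ρ n)
      ≡⟨ solve 3 (λ i e r → i :* (e :* r) := (i :* r) :* e) refl (ι n) ε (ρ n) ⟩
    (ι n * ρ n) * ε               ≡⟨ cong (_* ε) (ι*ρ≡1 n) ⟩
    1ℚ * ε                        ≡⟨ ℚ.*-identityˡ ε ⟩
    ε                             ∎
    where open ℚ.≤-Reasoning

-- Means of multiplicative functions of one variable

∑ : ℕ → (ℕ → ℚ) → ℚ
∑ zero    h = 0ℚ
∑ (suc n) h = ∑ n h + h (suc n)

-- The ranges of `∑` and `∏` differ on purpose: entries of a tuple start at 1, while `∏` follows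
-- `upTo`, so that the primes p ≤ y are those reached by `suc y`.
∏ : (ℕ → ℚ) → ℕ → ℚ
∏ g zero    = 1ℚ
∏ g (suc n) = ∏ g n * g n

∑-cong : ∀ {h g} n → (∀ a → h a ≡ g a) → ∑ n h ≡ ∑ n g
∑-cong zero    eq = refl
∑-cong (suc n) eq = cong₂ _+_ (∑-cong n eq) (eq (suc n))

∑-mono : ∀ {h g} n → (∀ a → 1 ℕ.≤ a → a ℕ.≤ n → h a ≤ g a) → ∑ n h ≤ ∑ n g
∑-mono zero    le = ℚ.≤-refl
∑-mono (suc n) le = ℚ.+-mono-≤ (∑-mono n λ a 1≤a a≤n → le a 1≤a (ℕ.m≤n⇒m≤1+n a≤n))
  (le (suc n) (s≤s z≤n) ℕ.≤-refl)

∑-+ : ∀ h g n → ∑ n (λ a → h a + g a) ≡ ∑ n h + ∑ n g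
∑-+ h g zero    = refl
∑-+ h g (suc n) = trans (cong (_+ (h (suc n) + g (suc n))) (∑-+ h g n))
  (solve 4 (λ x y z w → (x :+ y) :+ (z :+ w) := (x :+ z) :+ (y :+ w)) refl
    (∑ n h) (∑ n g) (h (suc n)) (g (suc n)))

∑-*ˡ : ∀ c h n → ∑ n (λ a → c * h a) ≡ c * ∑ n h
∑-*ˡ c h zero    = sym (ℚ.*-zeroʳ c)
∑-*ˡ c h (suc n) = trans (cong (_+ c * h (suc n)) (∑-*ˡ c h n))
  (sym (ℚ.*-distribˡ-+ c (∑ n h) (h (suc n))))

∑-const : ∀ c n → ∑ n (λ _ → c) ≡ ι n * c
∑-const c zero    = sym (ℚ.*-zeroˡ c)
∑-const c (suc n) = begin
  ∑ n (λ _ → c) + c   ≡⟨ cong (_+ c) (∑-const c n) ⟩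
  ι n * c + c         ≡⟨ solve 2 (λ i c → i :* c :+ c := (con 1ℚ :+ i) :* c) refl (ι n) c ⟩
  (1ℚ + ι n) * c      ≡⟨ cong (_* c) (sym (ι-suc n)) ⟩
  ι (suc n) * c       ∎
  where open ≡-Reasoning

∑-nonneg : ∀ {h} n → (∀ a → 0ℚ ≤ h a) → 0ℚ ≤ ∑ n h
∑-nonneg zero    0≤h = ℚ.≤-refl
∑-nonneg (suc n) 0≤h = +-nonneg (∑-nonneg n 0≤h) (0≤h (suc n))

∏-cong : ∀ {h g} n → (∀ a → a ℕ.< n → h a ≡ g a) → ∏ h n ≡ ∏ g n
∏-cong zero    eq = refl
∏-cong (suc n) eq = cong₂ _*_ (∏-cong n λ a a<n → eq a (ℕ.m<n⇒m<1+n a<n)) (eq n ℕ.≤-refl)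

∏-* : ∀ h g n → ∏ (λ a → h a * g a) n ≡ ∏ h n * ∏ g n
∏-* h g zero    = refl
∏-* h g (suc n) = trans (cong (_* (h n * g n)) (∏-* h g n))
  (solve 4 (λ x y z w → (x :* y) :* (z :* w) := (x :* z) :* (y :* w)) refl
    (∏ h n) (∏ g n) (h n) (g n))

∏-1 : ∀ n → ∏ (λ _ → 1ℚ) n ≡ 1ℚ
∏-1 zero    = refl
∏-1 (suc n) = trans (ℚ.*-identityʳ _) (∏-1 n)

bit : ∀ {P : Set} → Dec P → ℕ
bit (yes _) = 1
bit (no  _) = 0

bit-yes : ∀ {P : Set} (P? : Dec P) → P → bit P? ≡ 1
bit-yes (yes _) _ = refl
bit-yes (no ¬p) p = contradiction p ¬p

bit-no : ∀ {P : Set} (P? : Dec P) → ¬ P → bit P? ≡ 0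
bit-no (yes p) ¬p = contradiction p ¬p
bit-no (no _)  _  = refl

infix 8 [_∣_]
[_∣_] : ℕ → ℕ → ℕ
[ d ∣ a ] = bit (d ∣? a)

[1∣] : ∀ a → [ 1 ∣ a ] ≡ 1
[1∣] a = bit-yes (1 ∣? a) (1∣ a)

-- If a = q * d and p divides a, Euclid's lemma moves p into q because p does not divide d.
[*∣] : ∀ {d p} a → Prime p → p ∤ d → [ d ℕ.* p ∣ a ] ≡ [ d ∣ a ] ℕ.* [ p ∣ a ]
[*∣] {d} {p} a pr p∤d with d ∣? a | p ∣? a
... | no d∤a  | _       = bit-no _ (d∤a ∘ ∣-trans (m∣m*n p))
... | yes _   | no p∤a  = bit-no _ (p∤a ∘ ∣-trans (n∣m*n d))
... | yes (divides q refl) | yes p∣a = bit-yes _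
  ([ (λ { (divides r refl) → divides r (trans (ℕ.*-assoc r p d) (cong (r ℕ.*_) (ℕ.*-comm p d))) })
   , (λ p∣d → contradiction p∣d p∤d) ]′ (euclidsLemma q d pr p∣a))

ρ-* : ∀ m n → ρ (m ℕ.* n) ≡ ρ m * ρ n
ρ-* zero    n       = sym (ℚ.*-zeroˡ (ρ n))
ρ-* m       zero    = trans (cong ρ (ℕ.*-zeroʳ m)) (sym (ℚ.*-zeroʳ (ρ m)))
ρ-* m@(suc _) n@(suc _) = ι-cancel (m ℕ.* n) (begin
  ι (m ℕ.* n) * ρ (m ℕ.* n)       ≡⟨ ι*ρ≡1 (m ℕ.* n) ⟩
  1ℚ * 1ℚ                         ≡⟨ cong₂ _*_ (sym (ι*ρ≡1 m)) (sym (ι*ρ≡1 n)) ⟩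
  (ι m * ρ m) * (ι n * ρ n)
    ≡⟨ solve 4 (λ a b c d → (a :* b) :* (c :* d) := (a :* c) :* (b :* d)) refl (ι m) (ρ m) (ι n) (ρ n) ⟩
  (ι m * ι n) * (ρ m * ρ n)       ≡⟨ cong (_* (ρ m * ρ n)) (sym (ι-* m n)) ⟩
  ι (m ℕ.* n) * (ρ m * ρ n)       ∎)
  where open ≡-Reasoning

-- Division with remainder is carried out while counting: a new multiple of d is met exactly when
-- the remainder would reach d.
∑[∣] : ∀ d .{{_ : ℕ.NonZero d}} n →
  ∃[ N ] ∃[ r ] (∑ n (λ a → ι [ d ∣ a ]) ≡ ι N × d ℕ.* N ℕ.+ r ≡ n × r ℕ.< d)
∑[∣] d zero = 0 , 0 , refl , cong (ℕ._+ 0) (ℕ.*-zeroʳ d) , ℕ.>-nonZero⁻¹ d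
∑[∣] d (suc n) with ∑[∣] d n
... | N , r , ∑≡N , dN+r≡n , r<d with d ∣? suc n
...   | yes d∣1+n = suc N , 0 , eq , remainder , ℕ.>-nonZero⁻¹ d
  where
  1+n≡ : suc n ≡ d ℕ.* N ℕ.+ suc r
  1+n≡ = trans (cong suc (sym dN+r≡n)) (sym (ℕ.+-suc (d ℕ.* N) r))

  1+r≡d : suc r ≡ d
  1+r≡d = ℕ.≤-antisym r<d
    (∣⇒≤ (∣m+n∣m⇒∣n (subst (d ∣_) 1+n≡ d∣1+n) (m∣m*n N)))

  eq : ∑ n (λ a → ι [ d ∣ a ]) + 1ℚ ≡ ι (suc N)
  eq = trans (cong (_+ 1ℚ) ∑≡N) (trans (ℚ.+-comm (ι N) 1ℚ) (sym (ι-suc N)))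

  remainder : d ℕ.* suc N ℕ.+ 0 ≡ suc n
  remainder = trans (ℕ.+-identityʳ _) (trans (ℕ.*-suc d N)
    (trans (ℕ.+-comm d _) (sym (trans 1+n≡ (cong (d ℕ.* N ℕ.+_) 1+r≡d)))))
...   | no d∤1+n = N , suc r , trans (ℚ.+-identityʳ _) ∑≡N , trans (ℕ.+-suc _ r) (cong suc dN+r≡n)
  , ℕ.≤∧≢⇒< r<d λ 1+r≡d → d∤1+n (subst (d ∣_)
      (trans (ℕ.+-suc _ r) (cong suc dN+r≡n))
      (∣m∣n⇒∣m+n (m∣m*n N) (subst (d ∣_) (sym 1+r≡d) ∣-refl)))

-- The error e is the fractional part of n / d.
∑[∣]-estimate : ∀ d .{{_ : ℕ.NonZero d}} n →
  ∃[ e ] (ι n * ρ d ≡ ∑ n (λ a → ι [ d ∣ a ]) + e × 0ℚ ≤ e × e ≤ 1ℚ)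
∑[∣]-estimate d n with ∑[∣] d n
... | N , r , ∑≡N , refl , r<d = ι r * ρ d , eq , *-nonneg (0≤ι r) (0≤ρ d) , e≤1
  where
  eq : ι (d ℕ.* N ℕ.+ r) * ρ d ≡ ∑ (d ℕ.* N ℕ.+ r) (λ a → ι [ d ∣ a ]) + ι r * ρ d
  eq = begin
    ι (d ℕ.* N ℕ.+ r) * ρ d
      ≡⟨ cong (_* ρ d) (trans (ι-+ (d ℕ.* N) r) (cong (_+ ι r) (ι-* d N))) ⟩
    (ι d * ι N + ι r) * ρ d
      ≡⟨ solve 4 (λ a b c e → (a :* b :+ c) :* e := (a :* e) :* b :+ c :* e) refl (ι d) (ι N) (ι r) (ρ d) ⟩
    (ι d * ρ d) * ι N + ι r * ρ d     ≡⟨ cong (λ x → x * ι N + ι r * ρ d) (ι*ρ≡1 d) ⟩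
    1ℚ * ι N + ι r * ρ d              ≡⟨ cong (_+ ι r * ρ d) (ℚ.*-identityˡ (ι N)) ⟩
    ι N + ι r * ρ d                   ≡⟨ cong (_+ ι r * ρ d) (sym ∑≡N) ⟩
    ∑ (d ℕ.* N ℕ.+ r) (λ a → ι [ d ∣ a ]) + ι r * ρ d ∎
    where open ≡-Reasoning

  e≤1 : ι r * ρ d ≤ 1ℚ
  e≤1 = subst (ι r * ρ d ≤_) (ι*ρ≡1 d)
    (*-monoʳ (ρ d) (0≤ρ d) (ι-mono {r} {d} (ℕ.<⇒≤ r<d)))

∣xA+zB∣≤ : ∀ x z A B {e} → ∣ x ∣ ≤ 1ℚ → ∣ z ∣ ≤ 1ℚ → ∣ A ∣ ≤ e → ∣ B ∣ ≤ e →
  ∣ x * A + z * B ∣ ≤ e + e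
∣xA+zB∣≤ x z A B {e} x≤1 z≤1 A≤e B≤e = ℚ.≤-trans (ℚ.∣p+q∣≤∣p∣+∣q∣ (x * A) (z * B))
  (ℚ.+-mono-≤ (scale x A x≤1 A≤e) (scale z B z≤1 B≤e))
  where
  scale : ∀ x A → ∣ x ∣ ≤ 1ℚ → ∣ A ∣ ≤ e → ∣ x * A ∣ ≤ e
  scale x A x≤1 A≤e = subst₂ _≤_ (sym (ℚ.∣p*q∣≡∣p∣*∣q∣ x A)) (ℚ.*-identityˡ e)
    (*-mono 0≤1 (ℚ.0≤∣p∣ A) x≤1 A≤e)

-- Any function of whether p divides a is affine in `[ p ∣ a ]`. The bounds by 1 keep the
-- coefficients of the expanded product from amplifying errors, and z = 0 off the primes ensures
-- that only squarefree divisors arise.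
module OneVariable (x z : ℕ → ℚ)
  (∣x∣≤1 : ∀ p → ∣ x p ∣ ≤ 1ℚ) (∣z∣≤1 : ∀ p → ∣ z p ∣ ≤ 1ℚ)
  (z≡0 : ∀ p → ¬ Prime p → z p ≡ 0ℚ) where

  φ : ℕ → ℕ → ℚ
  φ a p = x p + z p * ι [ p ∣ a ]

  -- The limiting mean of `φ a p` over a, since p divides a with density 1/p.
  μ : ℕ → ℚ
  μ p = x p + z p * ρ p

  -- The divisor d records the primes already split off from the product; without it the induction
  -- on N would not close.
  term : ℕ → ℕ → ℕ → ℚ
  term d N a = ι [ d ∣ a ] * ∏ (φ a) N

  error : ℕ → ℕ → ℕ → ℚ
  error n d N = ∑ n (term d N) - ι n * ρ d * ∏ μ N

  -- The factor for N splits the sum: its constant part leaves d unchanged and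
  -- its other part replaces d by d * N.
  error-suc : ∀ n d N → Prime N → N ∤ d →
    error n d (suc N) ≡ x N * error n d N + z N * error n (d ℕ.* N) N
  error-suc n d N pr N∤d = begin
    ∑ n (term d (suc N)) - ι n * ρ d * (∏ μ N * μ N)
      ≡⟨ cong (_- ι n * ρ d * (∏ μ N * μ N)) (trans (∑-cong n split) (trans (∑-+ _ _ n)
           (cong₂ _+_ (∑-*ˡ (x N) (term d N) n) (∑-*ˡ (z N) (term (d ℕ.* N) N) n)))) ⟩
    x N * S₁ + z N * S₂ - ι n * ρ d * (∏ μ N * μ N)
      ≡⟨ solve 8 (λ x z s t i r π q →
           x :* s :+ z :* t :- i :* r :* (π :* (x :+ z :* q))
           := x :* (s :- i :* r :* π) :+ z :* (t :- i :* (r :* q) :* π)) refl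
           (x N) (z N) S₁ S₂ (ι n) (ρ d) (∏ μ N) (ρ N) ⟩
    x N * error n d N + z N * (S₂ - ι n * (ρ d * ρ N) * ∏ μ N)
      ≡⟨ cong (λ r → x N * error n d N + z N * (S₂ - ι n * r * ∏ μ N)) (sym (ρ-* d N)) ⟩
    x N * error n d N + z N * error n (d ℕ.* N) N ∎
    where
    open ≡-Reasoning
    S₁ = ∑ n (term d N)
    S₂ = ∑ n (term (d ℕ.* N) N)

    split : ∀ a → term d (suc N) a ≡ x N * term d N a + z N * term (d ℕ.* N) N a
    split a = trans
      (solve 5 (λ b π x z c → b :* (π :* (x :+ z :* c)) := x :* (b :* π) :+ z :* (b :* c :* π)) refl
        (ι [ d ∣ a ]) (∏ (φ a) N) (x N) (z N) (ι [ N ∣ a ]))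
      (cong (λ b → x N * term d N a + z N * (b * ∏ (φ a) N))
        (trans (sym (ι-* [ d ∣ a ] [ N ∣ a ])) (cong ι (sym ([*∣] a pr N∤d)))))

  -- The summand `z N * 0ℚ` gives the right side the same shape as in `error-suc`, so that
  -- `∣xA+zB∣≤` serves both cases.
  error-suc-nonprime : ∀ n d N → ¬ Prime N →
    error n d (suc N) ≡ x N * error n d N + z N * 0ℚ
  error-suc-nonprime n d N ¬pr = begin
    ∑ n (term d (suc N)) - ι n * ρ d * (∏ μ N * (x N + z N * ρ N))
      ≡⟨ cong₂ _-_ (trans (∑-cong n scale) (∑-*ˡ (x N) (term d N) n))
           (cong (λ z → ι n * ρ d * (∏ μ N * (x N + z * ρ N))) (z≡0 N ¬pr)) ⟩
    x N * ∑ n (term d N) - ι n * ρ d * (∏ μ N * (x N + 0ℚ * ρ N))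
      ≡⟨ solve 6 (λ x z s t π q → x :* s :- t :* (π :* (x :+ con 0ℚ :* q))
           := x :* (s :- t :* π) :+ z :* con 0ℚ) refl
           (x N) (z N) (∑ n (term d N)) (ι n * ρ d) (∏ μ N) (ρ N) ⟩
    x N * error n d N + z N * 0ℚ ∎
    where
    open ≡-Reasoning
    scale : ∀ a → term d (suc N) a ≡ x N * term d N a
    scale a = trans
      (cong (λ z → ι [ d ∣ a ] * (∏ (φ a) N * (x N + z * ι [ N ∣ a ]))) (z≡0 N ¬pr))
      (solve 4 (λ b π x c → b :* (π :* (x :+ con 0ℚ :* c)) := x :* (b :* π)) refl
        (ι [ d ∣ a ]) (∏ (φ a) N) (x N) (ι [ N ∣ a ]))

  -- Each factor splits one error into two with coefficients of size at most 1, whence the power of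
  -- 2; at N = 0 only the fractional part of n / d is left. The primes still to come must not divide
  -- d, as `[*∣]` requires, and this survives the passage to d * N because N is a prime larger than
  -- all of them.
  ∣error∣≤ : ∀ N d → .{{ℕ.NonZero d}} → (∀ p → Prime p → p ℕ.< N → p ∤ d) →
    ∀ n → ∣ error n d N ∣ ≤ ι (2 ℕ.^ N)
  ∣error∣≤ zero d _ n with ∑[∣]-estimate d n
  ... | e , eq , 0≤e , e≤1 = subst (_≤ 1ℚ) (sym (begin
    ∣ ∑ n (term d 0) - ι n * ρ d * 1ℚ ∣
      ≡⟨ cong₂ (λ s t → ∣ s - t ∣) (∑-cong n λ a → ℚ.*-identityʳ _) (trans (ℚ.*-identityʳ _) eq) ⟩
    ∣ s - (s + e) ∣       ≡⟨ ∣-∣-comm s (s + e) ⟩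
    ∣ (s + e) - s ∣       ≡⟨ cong ∣_∣ (solve 2 (λ s e → (s :+ e) :- s := e) refl s e) ⟩
    ∣ e ∣                 ≡⟨ ℚ.0≤p⇒∣p∣≡p 0≤e ⟩
    e                     ∎)) e≤1
    where
    open ≡-Reasoning
    s = ∑ n (λ a → ι [ d ∣ a ])
  ∣error∣≤ (suc N) d {{d≢0}} p∤d n = subst (∣ error n d (suc N) ∣ ≤_) (sym double) step
    where
    p∤d′ : ∀ p → Prime p → p ℕ.< N → p ∤ d
    p∤d′ p pr p<N = p∤d p pr (ℕ.m<n⇒m<1+n p<N)

    double : ι (2 ℕ.^ suc N) ≡ ι (2 ℕ.^ N) + ι (2 ℕ.^ N)
    double = trans (cong (λ m → ι (2 ℕ.^ N ℕ.+ m)) (ℕ.+-identityʳ (2 ℕ.^ N))) (ι-+ (2 ℕ.^ N) (2 ℕ.^ N))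

    step : ∣ error n d (suc N) ∣ ≤ ι (2 ℕ.^ N) + ι (2 ℕ.^ N)
    step with prime? N
    ... | yes pr = subst (λ e → ∣ e ∣ ≤ _) (sym (error-suc n d N pr (p∤d N pr ℕ.≤-refl)))
      (∣xA+zB∣≤ (x N) (z N) (error n d N) (error n (d ℕ.* N) N) (∣x∣≤1 N) (∣z∣≤1 N)
        (∣error∣≤ N d p∤d′ n)
        (∣error∣≤ N (d ℕ.* N) {{ℕ.m*n≢0 d N {{d≢0}} {{prime⇒nonZero pr}}}} p∤dN n))
      where
      p∤dN : ∀ p → Prime p → p ℕ.< N → p ∤ d ℕ.* N
      p∤dN p prp p<N p∣dN with euclidsLemma d N prp p∣dN
      ... | inj₁ p∣d = p∤d′ p prp p<N p∣d
      ... | inj₂ p∣N with prime⇒irreducible pr p∣N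
      ...   | inj₁ refl = contradiction (prime⇒nonTrivial prp) λ ()
      ...   | inj₂ refl = ℕ.<-irrefl refl p<N
    ... | no ¬pr = subst (λ e → ∣ e ∣ ≤ _) (sym (error-suc-nonprime n d N ¬pr))
      (∣xA+zB∣≤ (x N) (z N) (error n d N) 0ℚ (∣x∣≤1 N) (∣z∣≤1 N)
        (∣error∣≤ N d p∤d′ n) (0≤ι (2 ℕ.^ N)))

  ∣∑∏-main∣≤ : ∀ N n → ∣ ∑ n (λ a → ∏ (φ a) N) - ι n * ∏ μ N ∣ ≤ ι (2 ℕ.^ N)
  ∣∑∏-main∣≤ N n = subst (_≤ ι (2 ℕ.^ N))
    (cong₂ (λ s t → ∣ s - t ∣)
      (∑-cong n λ a → trans (cong (λ b → ι b * ∏ (φ a) N) ([1∣] a)) (ℚ.*-identityˡ _))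
      (cong (_* ∏ μ N) (ℚ.*-identityʳ (ι n))))
    (∣error∣≤ N 1 p∤1 n)
    where
    p∤1 : ∀ p → Prime p → p ℕ.< N → p ∤ 1
    p∤1 p pr _ p∣1 = ℕ.<⇒≱ (ℕ.nonTrivial⇒n>1 p {{prime⇒nonTrivial pr}}) (∣⇒≤ p∣1)

-- Means over tuples

private variable
  s : ℕ

∣p-q∣≤e⇒p≤q+e : ∀ p q {e} → ∣ p - q ∣ ≤ e → p ≤ q + e
∣p-q∣≤e⇒p≤q+e p q {e} le = subst (_≤ q + e)
  (solve 2 (λ p q → q :+ (p :- q) := p) refl p q)
  (ℚ.+-monoʳ-≤ q (ℚ.≤-trans (p≤∣p∣ (p - q)) le))

∣p-q∣≤ : ∀ p q {e} → p ≤ q + e → q ≤ p + e → ∣ p - q ∣ ≤ e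
∣p-q∣≤ p q {e} p≤ q≤ = ∣p∣≤q (move p q p≤)
  (subst (_≤ e) (solve 2 (λ p q → q :- p := :- (p :- q)) refl p q) (move q p q≤))
  where
  move : ∀ p q → p ≤ q + e → p - q ≤ e
  move p q p≤ = subst (p - q ≤_) (solve 2 (λ q e → (q :+ e) :- q := e) refl q e)
    (ℚ.+-monoˡ-≤ (- q) p≤)

avg : ℕ → (ℕ → ℚ) → ℚ
avg n h = ρ n * ∑ n h

avg-mono : ∀ {h g} n → (∀ a → 1 ℕ.≤ a → a ℕ.≤ n → h a ≤ g a) → avg n h ≤ avg n g
avg-mono n le = *-monoˡ (ρ n) (0≤ρ n) (∑-mono n le)

avg-cong : ∀ {h g} n → (∀ a → h a ≡ g a) → avg n h ≡ avg n g
avg-cong n eq = cong (ρ n *_) (∑-cong n eq)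

avg-+ : ∀ h g n → avg n (λ a → h a + g a) ≡ avg n h + avg n g
avg-+ h g n = trans (cong (ρ n *_) (∑-+ h g n)) (ℚ.*-distribˡ-+ (ρ n) _ _)

avg-*ˡ : ∀ c h n → avg n (λ a → c * h a) ≡ c * avg n h
avg-*ˡ c h n = trans (cong (ρ n *_) (∑-*ˡ c h n))
  (solve 3 (λ r c t → r :* (c :* t) := c :* (r :* t)) refl (ρ n) c (∑ n h))

avg-const : ∀ c n → .{{ℕ.NonZero n}} → avg n (λ _ → c) ≡ c
avg-const c n = begin
  ρ n * ∑ n (λ _ → c)   ≡⟨ cong (ρ n *_) (∑-const c n) ⟩
  ρ n * (ι n * c)       ≡⟨ solve 3 (λ r i c → r :* (i :* c) := i :* r :* c) refl (ρ n) (ι n) c ⟩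
  ι n * ρ n * c         ≡⟨ cong (_* c) (ι*ρ≡1 n) ⟩
  1ℚ * c                ≡⟨ ℚ.*-identityˡ c ⟩
  c                     ∎
  where open ≡-Reasoning

avg-+const : ∀ h c n → .{{ℕ.NonZero n}} → avg n (λ a → h a + c) ≡ avg n h + c
avg-+const h c n = trans (avg-+ h (λ _ → c) n) (cong (avg n h +_) (avg-const c n))

avg-close : ∀ {h g e} n → .{{ℕ.NonZero n}} → (∀ a → ∣ h a - g a ∣ ≤ e) → ∣ avg n h - avg n g ∣ ≤ e
avg-close {h} {g} {e} n close = ∣p-q∣≤ _ _
  (subst (avg n h ≤_) (avg-+const g e n)
    (avg-mono n λ a _ _ → ∣p-q∣≤e⇒p≤q+e (h a) (g a) (close a)))
  (subst (avg n g ≤_) (avg-+const h e n)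
    (avg-mono n λ a _ _ → ∣p-q∣≤e⇒p≤q+e (g a) (h a) (subst (_≤ e) (∣-∣-comm (h a) (g a)) (close a))))

avg[∣]≤ρ : ∀ d → .{{ℕ.NonZero d}} → ∀ n → .{{ℕ.NonZero n}} → avg n (λ a → ι [ d ∣ a ]) ≤ ρ d
avg[∣]≤ρ d n with ∑[∣]-estimate d n
... | e , eq , 0≤e , _ = begin
  ρ n * ∑ n (λ a → ι [ d ∣ a ])   ≤⟨ *-monoˡ (ρ n) (0≤ρ n) (≤-from-sub 0≤e (sym eq)) ⟩
  ρ n * (ι n * ρ d)
    ≡⟨ solve 3 (λ r i c → r :* (i :* c) := i :* r :* c) refl (ρ n) (ι n) (ρ d) ⟩
  ι n * ρ n * ρ d                 ≡⟨ cong (_* ρ d) (ι*ρ≡1 n) ⟩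
  1ℚ * ρ d                        ≡⟨ ℚ.*-identityˡ (ρ d) ⟩
  ρ d                             ∎
  where open ℚ.≤-Reasoning

-- An iterated average, so that one entry can be peeled off at a time; `sumℚ-tuples` identifies it
-- with the normalised sum over `tuples`.
mean : ∀ s → ℕ → (Vec ℕ s → ℚ) → ℚ
mean zero    n g = g []
mean (suc s) n g = avg n (λ a → mean s n (λ as → g (a ∷ as)))

InRange : ℕ → ℕ → Set
InRange n a = 1 ℕ.≤ a × a ℕ.≤ n

mean-mono : ∀ s n {h g} → (∀ as → All (InRange n) as → h as ≤ g as) → mean s n h ≤ mean s n g
mean-mono zero    n le = le [] []
mean-mono (suc s) n le = avg-mono n λ a 1≤a a≤n → mean-mono s n λ as r → le (a ∷ as) ((1≤a , a≤n) ∷ r)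

mean-cong : ∀ s n {h g} → (∀ as → h as ≡ g as) → mean s n h ≡ mean s n g
mean-cong zero    n eq = eq []
mean-cong (suc s) n eq = avg-cong n λ a → mean-cong s n λ as → eq (a ∷ as)

mean-+ : ∀ s n h g → mean s n (λ as → h as + g as) ≡ mean s n h + mean s n g
mean-+ zero    n h g = refl
mean-+ (suc s) n h g = trans (avg-cong n λ a → mean-+ s n _ _) (avg-+ _ _ n)

mean-*ˡ : ∀ s n c h → mean s n (λ as → c * h as) ≡ c * mean s n h
mean-*ˡ zero    n c h = refl
mean-*ˡ (suc s) n c h = trans (avg-cong n λ a → mean-*ˡ s n c _) (avg-*ˡ c _ n)

mean-const : ∀ s n → .{{ℕ.NonZero n}} → ∀ c → mean s n (λ _ → c) ≡ c
mean-const zero    n c = refl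
mean-const (suc s) n c = trans (avg-cong n λ a → mean-const s n c) (avg-const c n)

mean-∑ : ∀ s n → .{{ℕ.NonZero n}} → ∀ m (h : ℕ → Vec ℕ s → ℚ) →
  mean s n (λ as → ∑ m (λ j → h j as)) ≡ ∑ m (λ j → mean s n (h j))
mean-∑ s n zero    h = mean-const s n 0ℚ
mean-∑ s n (suc m) h = trans (mean-+ s n _ _) (cong (_+ mean s n (h (suc m))) (mean-∑ s n m h))

-- The sieve by finitely many primes and its density

hits : ℕ → Vec ℕ s → ℕ
hits p []       = 0
hits p (a ∷ as) = [ p ∣ a ] ℕ.+ hits p as

-- The indicator of c < t, by recursion on both arguments so that `χ-shift` holds by computation.
χ : ℕ → ℕ → ℚ
χ c       zero    = 0ℚ
χ zero    (suc t) = 1ℚ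
χ (suc c) (suc t) = χ c t

χ-cases : ∀ c t → (χ c t ≡ 0ℚ × t ℕ.≤ c) ⊎ (χ c t ≡ 1ℚ × c ℕ.< t)
χ-cases c       zero    = inj₁ (refl , z≤n)
χ-cases zero    (suc t) = inj₂ (refl , s≤s z≤n)
χ-cases (suc c) (suc t) with χ-cases c t
... | inj₁ (eq , le) = inj₁ (eq , s≤s le)
... | inj₂ (eq , lt) = inj₂ (eq , s≤s lt)

-- Truncated subtraction does no harm: a threshold of 0 cannot be met, whatever the count.
χ-shift : ∀ {P : Set} (P? : Dec P) c t → χ (bit P? ℕ.+ c) t ≡ χ c (t ∸ bit P?)
χ-shift (no _)  c t       = refl
χ-shift (yes _) c zero    = refl
χ-shift (yes _) c (suc t) = refl

ifDec : ∀ {P : Set} → Dec P → ℚ → ℚ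
ifDec (yes _) q = q
ifDec (no  _) q = 1ℚ

-- The indicator of the conditions at the primes below N, kept as a product because a new entry acts
-- on each factor separately.
sieve : ℕ → (ℕ → ℕ) → Vec ℕ s → ℚ
sieve N τ as = ∏ (λ p → ifDec (prime? p) (χ (hits p as) (τ p))) N

-- The probability that at most t - 1 of s independent events occur, each of
-- them having probability r = 1 - q.
binomialCDF : ℚ → ℚ → ℕ → ℕ → ℚ
binomialCDF q r zero    t = χ 0 t
binomialCDF q r (suc s) t = q * binomialCDF q r s t + r * binomialCDF q r s (t ∸ 1)

localDensity : ℕ → ℕ → ℕ → ℚ
localDensity s p t = binomialCDF (1ℚ - ρ p) (ρ p) s t

density : ℕ → ℕ → (ℕ → ℕ) → ℚ
density s N τ = ∏ (λ p → ifDec (prime? p) (localDensity s p (τ p))) N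

ρ≤1 : ∀ n → ρ n ≤ 1ℚ
ρ≤1 zero    = 0≤1
ρ≤1 n@(suc m) = subst₂ _≤_ (ℚ.*-identityˡ (ρ n)) (ι*ρ≡1 n)
  (*-monoʳ (ρ n) (0≤ρ n) (ι-mono {1} {n} (s≤s z≤n)))

localDensity-bounds : ∀ s p t → 0ℚ ≤ localDensity s p t × localDensity s p t ≤ 1ℚ
localDensity-bounds zero p t with χ-cases 0 t
... | inj₁ (eq , _) = ℚ.≤-reflexive (sym eq) , ℚ.≤-trans (ℚ.≤-reflexive eq) 0≤1
... | inj₂ (eq , _) = ℚ.≤-trans 0≤1 (ℚ.≤-reflexive (sym eq)) , ℚ.≤-reflexive eq
localDensity-bounds (suc s) p t = lower , upper
  where
  open ℚ.≤-Reasoning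
  0≤q = p≤q⇒0≤q-p (ρ≤1 p)

  lower : 0ℚ ≤ localDensity (suc s) p t
  lower = +-nonneg (*-nonneg 0≤q (proj₁ (localDensity-bounds s p t)))
    (*-nonneg (0≤ρ p) (proj₁ (localDensity-bounds s p (t ∸ 1))))

  upper : localDensity (suc s) p t ≤ 1ℚ
  upper = begin
    (1ℚ - ρ p) * localDensity s p t + ρ p * localDensity s p (t ∸ 1)
      ≤⟨ ℚ.+-mono-≤ (*-monoˡ _ 0≤q (proj₂ (localDensity-bounds s p t)))
           (*-monoˡ _ (0≤ρ p) (proj₂ (localDensity-bounds s p (t ∸ 1)))) ⟩
    (1ℚ - ρ p) * 1ℚ + ρ p * 1ℚ
      ≡⟨ solve 1 (λ r → (con 1ℚ :- r) :* con 1ℚ :+ r :* con 1ℚ := con 1ℚ) refl (ρ p) ⟩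
    1ℚ ∎

∣p-q∣≤1 : ∀ {p q} → 0ℚ ≤ p × p ≤ 1ℚ → 0ℚ ≤ q × q ≤ 1ℚ → ∣ p - q ∣ ≤ 1ℚ
∣p-q∣≤1 {p} {q} (0≤p , p≤1) (0≤q , q≤1) =
  ∣p-q∣≤ p q (ℚ.≤-trans p≤1 (≤-from-sub 0≤q (ℚ.+-comm 1ℚ q)))
    (ℚ.≤-trans q≤1 (≤-from-sub 0≤p (ℚ.+-comm 1ℚ p)))

-- A new entry a lowers the threshold at p by `[ p ∣ a ]`. The density for the other s entries thus
-- becomes a product of affine functions of `[ p ∣ a ]`, which is the setting of `OneVariable`.
module _ (s N : ℕ) (τ : ℕ → ℕ) where

  constantPart : ℕ → ℚ
  constantPart p = ifDec (prime? p) (localDensity s p (τ p))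

  slope : ℕ → ℚ
  slope p with prime? p
  ... | yes _ = localDensity s p (τ p ∸ 1) - localDensity s p (τ p)
  ... | no  _ = 0ℚ

  ∣constantPart∣≤1 : ∀ p → ∣ constantPart p ∣ ≤ 1ℚ
  ∣constantPart∣≤1 p with prime? p
  ... | yes _ = subst (_≤ 1ℚ) (sym (ℚ.0≤p⇒∣p∣≡p (proj₁ (localDensity-bounds s p (τ p)))))
    (proj₂ (localDensity-bounds s p (τ p)))
  ... | no  _ = ℚ.≤-refl

  ∣slope∣≤1 : ∀ p → ∣ slope p ∣ ≤ 1ℚ
  ∣slope∣≤1 p with prime? p
  ... | yes _ = ∣p-q∣≤1 (localDensity-bounds s p (τ p ∸ 1)) (localDensity-bounds s p (τ p))
  ... | no  _ = 0≤1

  slope≡0 : ∀ p → ¬ Prime p → slope p ≡ 0ℚ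
  slope≡0 p ¬pr with prime? p
  ... | yes pr = contradiction pr ¬pr
  ... | no  _  = refl

  open OneVariable constantPart slope ∣constantPart∣≤1 ∣slope∣≤1 slope≡0
    using (φ; μ; ∣∑∏-main∣≤) public

  density-shift : ∀ a → density s N (λ p → τ p ∸ [ p ∣ a ]) ≡ ∏ (φ a) N
  density-shift a = ∏-cong N λ p _ → factor p
    where
    factor : ∀ p → ifDec (prime? p) (localDensity s p (τ p ∸ [ p ∣ a ])) ≡ φ a p
    factor p with prime? p | p ∣? a
    ... | no  _ | p∣?a  = solve 1 (λ b → con 1ℚ := con 1ℚ :+ con 0ℚ :* b) refl (ι (bit p∣?a))
    ... | yes _ | yes _ = solve 2 (λ g f → g := f :+ (g :- f) :* con 1ℚ) refl
      (localDensity s p (τ p ∸ 1)) (localDensity s p (τ p))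
    ... | yes _ | no _  = solve 2 (λ g f → f := f :+ (g :- f) :* con 0ℚ) refl
      (localDensity s p (τ p ∸ 1)) (localDensity s p (τ p))

  -- Weighting the two values of the affine factor by 1 - 1/p and 1/p is the recursion that defines
  -- `binomialCDF`.
  density-suc : density (suc s) N τ ≡ ∏ μ N
  density-suc = ∏-cong N λ p _ → factor p
    where
    factor : ∀ p → ifDec (prime? p) (localDensity (suc s) p (τ p)) ≡ μ p
    factor p with prime? p
    ... | no  _ = solve 1 (λ r → con 1ℚ := con 1ℚ :+ con 0ℚ :* r) refl (ρ p)
    ... | yes _ = solve 3 (λ r f g → (con 1ℚ :- r) :* f :+ r :* g := f :+ (g :- f) :* r) refl
                    (ρ p) (localDensity s p (τ p)) (localDensity s p (τ p ∸ 1))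

sieve-∷ : ∀ N τ a (as : Vec ℕ s) → sieve N τ (a ∷ as) ≡ sieve N (λ p → τ p ∸ [ p ∣ a ]) as
sieve-∷ N τ a as = ∏-cong N λ p _ → cong (ifDec (prime? p)) (χ-shift (p ∣? a) (hits p as) (τ p))

avg-∏ : ∀ s N τ n → .{{ℕ.NonZero n}} →
  ∣ avg n (λ a → density s N (λ p → τ p ∸ [ p ∣ a ])) - density (suc s) N τ ∣ ≤ ι (2 ℕ.^ N) * ρ n
avg-∏ s N τ n = begin
  ∣ avg n (λ a → density s N (λ p → τ p ∸ [ p ∣ a ])) - density (suc s) N τ ∣
    ≡⟨ cong₂ (λ x y → ∣ x - y ∣) (avg-cong n (density-shift s N τ))
         (trans (density-suc s N τ) (sym (ℚ.*-identityˡ (∏ m N)))) ⟩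
  ∣ ρ n * S - 1ℚ * ∏ m N ∣
    ≡⟨ cong (λ i → ∣ ρ n * S - i * ∏ m N ∣) (sym (ι*ρ≡1 n)) ⟩
  ∣ ρ n * S - ι n * ρ n * ∏ m N ∣
    ≡⟨ cong ∣_∣ (solve 4 (λ r s i d → r :* s :- i :* r :* d := r :* (s :- i :* d)) refl
         (ρ n) S (ι n) (∏ m N)) ⟩
  ∣ ρ n * (S - ι n * ∏ m N) ∣
    ≡⟨ ℚ.∣p*q∣≡∣p∣*∣q∣ (ρ n) _ ⟩
  ∣ ρ n ∣ * ∣ S - ι n * ∏ m N ∣
    ≡⟨ cong (_* ∣ S - ι n * ∏ m N ∣) (ℚ.0≤p⇒∣p∣≡p (0≤ρ n)) ⟩
  ρ n * ∣ S - ι n * ∏ m N ∣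
    ≤⟨ *-monoˡ (ρ n) (0≤ρ n) (∣∑∏-main∣≤ s N τ N n) ⟩
  ρ n * ι (2 ℕ.^ N)
    ≡⟨ ℚ.*-comm (ρ n) _ ⟩
  ι (2 ℕ.^ N) * ρ n ∎
  where
  open ℚ.≤-Reasoning
  m = μ s N τ
  S = ∑ n (λ a → ∏ (φ s N τ a) N)

-- The induction hypothesis is used at the shifted thresholds of every first entry a. Its bound does
-- not depend on them, so it survives averaging over a, and each entry costs one further error of
-- `avg-∏`.
mean-sieve : ∀ s N τ n → .{{ℕ.NonZero n}} →
  ∣ mean s n (sieve N τ) - density s N τ ∣ ≤ ι s * (ι (2 ℕ.^ N) * ρ n)
mean-sieve zero N τ n = ℚ.≤-reflexive (trans
  (cong ∣_∣ (ℚ.+-inverseʳ (density 0 N τ))) (sym (ℚ.*-zeroˡ (ι (2 ℕ.^ N) * ρ n))))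
mean-sieve (suc s) N τ n = begin
  ∣ mean (suc s) n (sieve N τ) - density (suc s) N τ ∣
    ≤⟨ ∣-∣-triangle (mean (suc s) n (sieve N τ)) (avg n λ a → density s N (shift a)) (density (suc s) N τ) ⟩
  ∣ mean (suc s) n (sieve N τ) - avg n (λ a → density s N (shift a)) ∣
    + ∣ avg n (λ a → density s N (shift a)) - density (suc s) N τ ∣
    ≤⟨ ℚ.+-mono-≤ (avg-close n λ a → subst (λ e → ∣ e - density s N (shift a) ∣ ≤ ι s * K)
         (sym (mean-cong s n (sieve-∷ N τ a))) (mean-sieve s N (shift a) n)) (avg-∏ s N τ n) ⟩
  ι s * K + K
    ≡⟨ solve 2 (λ i k → i :* k :+ k := (con 1ℚ :+ i) :* k) refl (ι s) K ⟩
  (1ℚ + ι s) * K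
    ≡⟨ cong (_* K) (sym (ι-suc s)) ⟩
  ι (suc s) * K ∎
  where
  open ℚ.≤-Reasoning
  K = ι (2 ℕ.^ N) * ρ n
  shift : ℕ → ℕ → ℕ
  shift a p = τ p ∸ [ p ∣ a ]

-- The number of pairs of entries both divisible by d. It dominates the indicator of at least two
-- hits, and unlike that indicator it has a mean that splits over pairs of independent entries.
hitPairs : ℕ → Vec ℕ s → ℚ
hitPairs d []       = 0ℚ
hitPairs d (a ∷ as) = ι (hits d as) * ι [ d ∣ a ] + hitPairs d as

0≤hitPairs : ∀ d (as : Vec ℕ s) → 0ℚ ≤ hitPairs d as
0≤hitPairs d []       = ℚ.≤-refl
0≤hitPairs d (a ∷ as) = +-nonneg (*-nonneg (0≤ι (hits d as)) (0≤ι [ d ∣ a ])) (0≤hitPairs d as)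

1≤hitPairs : ∀ d (as : Vec ℕ s) → 2 ℕ.≤ hits d as → 1ℚ ≤ hitPairs d as
1≤hitPairs d (a ∷ as) 2≤ with d ∣? a
... | yes _ = begin
  1ℚ                                        ≤⟨ ι-mono {1} {hits d as} (ℕ.≤-pred 2≤) ⟩
  ι (hits d as)
    ≡⟨ solve 1 (λ h → h := h :* con 1ℚ :+ con 0ℚ) refl (ι (hits d as)) ⟩
  ι (hits d as) * 1ℚ + 0ℚ                   ≤⟨ ℚ.+-monoʳ-≤ (ι (hits d as) * 1ℚ) (0≤hitPairs d as) ⟩
  ι (hits d as) * 1ℚ + hitPairs d as        ∎
  where open ℚ.≤-Reasoning
... | no _ = ℚ.≤-trans (1≤hitPairs d as 2≤) (ℚ.≤-reflexive
  (solve 2 (λ h e → e := h :* con 0ℚ :+ e) refl (ι (hits d as)) (hitPairs d as)))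

mean-hits : ∀ s n → .{{ℕ.NonZero n}} → ∀ d → .{{ℕ.NonZero d}} →
  mean s n (λ as → ι (hits d as)) ≤ ι s * ρ d
mean-hits zero    n d = ℚ.≤-reflexive (sym (ℚ.*-zeroˡ (ρ d)))
mean-hits (suc s) n d = begin
  avg n (λ a → mean s n (λ as → ι ([ d ∣ a ] ℕ.+ hits d as)))
    ≡⟨ avg-cong n (λ a → trans (mean-cong s n λ as → ι-+ [ d ∣ a ] (hits d as))
         (trans (mean-+ s n _ _) (cong (_+ Es) (mean-const s n (ι [ d ∣ a ]))))) ⟩
  avg n (λ a → ι [ d ∣ a ] + Es)
    ≡⟨ avg-+const _ Es n ⟩
  avg n (λ a → ι [ d ∣ a ]) + Es
    ≤⟨ ℚ.+-mono-≤ (avg[∣]≤ρ d n) (mean-hits s n d) ⟩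
  ρ d + ι s * ρ d
    ≡⟨ solve 2 (λ r i → r :+ i :* r := (con 1ℚ :+ i) :* r) refl (ρ d) (ι s) ⟩
  (1ℚ + ι s) * ρ d
    ≡⟨ cong (_* ρ d) (sym (ι-suc s)) ⟩
  ι (suc s) * ρ d ∎
  where
  open ℚ.≤-Reasoning
  Es = mean s n (λ as → ι (hits d as))

-- For a fixed new entry the inner mean factors, the other entries being independent of it; the
-- constants then add up by Pascal's rule.
mean-hitPairs : ∀ s n → .{{ℕ.NonZero n}} → ∀ d → .{{ℕ.NonZero d}} →
  mean s n (hitPairs d) ≤ ι (s C 2) * (ρ d * ρ d)
mean-hitPairs zero    n d = ℚ.≤-reflexive (sym (ℚ.*-zeroˡ (ρ d * ρ d)))
mean-hitPairs (suc s) n d = begin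
  avg n (λ a → mean s n (λ as → ι (hits d as) * ι [ d ∣ a ] + hitPairs d as))
    ≡⟨ avg-cong n (λ a → trans (mean-+ s n _ _) (cong (_+ Ep)
         (trans (mean-cong s n λ as → ℚ.*-comm (ι (hits d as)) (ι [ d ∣ a ]))
           (trans (mean-*ˡ s n (ι [ d ∣ a ]) _) (ℚ.*-comm (ι [ d ∣ a ]) Eh))))) ⟩
  avg n (λ a → Eh * ι [ d ∣ a ] + Ep)
    ≡⟨ trans (avg-+const _ Ep n) (cong (_+ Ep) (avg-*ˡ Eh _ n)) ⟩
  Eh * avg n (λ a → ι [ d ∣ a ]) + Ep
    ≤⟨ ℚ.+-mono-≤ (*-mono (*-nonneg (0≤ι s) (0≤ρ d))
         (*-nonneg (0≤ρ n) (∑-nonneg n λ a → 0≤ι [ d ∣ a ])) (mean-hits s n d) (avg[∣]≤ρ d n))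
         (mean-hitPairs s n d) ⟩
  ι s * ρ d * ρ d + ι (s C 2) * (ρ d * ρ d)
    ≡⟨ solve 3 (λ i r j → i :* r :* r :+ j :* (r :* r) := (i :+ j) :* (r :* r)) refl (ι s) (ρ d) (ι (s C 2)) ⟩
  (ι s + ι (s C 2)) * (ρ d * ρ d)
    ≡⟨ cong (_* (ρ d * ρ d)) (trans (sym (ι-+ s (s C 2))) (cong ι pascal)) ⟩
  ι (suc s C 2) * (ρ d * ρ d) ∎
  where
  open ℚ.≤-Reasoning
  Eh = mean s n (λ as → ι (hits d as))
  Ep = mean s n (hitPairs d)

  pascal : s ℕ.+ s C 2 ≡ suc s C 2
  pascal = trans (cong (ℕ._+ s C 2) (sym (nC1≡n s))) (nCk+nC[k+1]≡[n+1]C[k+1] s 1)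

ρ-telescope : ∀ n → .{{ℕ.NonZero n}} → ρ n ≡ ρ n * ρ (suc n) + ρ (suc n)
ρ-telescope n = begin
  ρ n                                         ≡⟨ sym (ℚ.*-identityʳ (ρ n)) ⟩
  ρ n * 1ℚ                                    ≡⟨ cong (ρ n *_) (sym (ι*ρ≡1 (suc n))) ⟩
  ρ n * (ι (suc n) * ρ (suc n))               ≡⟨ cong (λ i → ρ n * (i * ρ (suc n))) (ι-suc n) ⟩
  ρ n * ((1ℚ + ι n) * ρ (suc n))
    ≡⟨ solve 3 (λ r i r′ → r :* ((con 1ℚ :+ i) :* r′) := r :* r′ :+ i :* r :* r′) refl (ρ n) (ι n) (ρ (suc n)) ⟩
  ρ n * ρ (suc n) + ι n * ρ n * ρ (suc n)
    ≡⟨ cong (λ i → ρ n * ρ (suc n) + i * ρ (suc n)) (ι*ρ≡1 n) ⟩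
  ρ n * ρ (suc n) + 1ℚ * ρ (suc n)            ≡⟨ cong (ρ n * ρ (suc n) +_) (ℚ.*-identityˡ (ρ (suc n))) ⟩
  ρ n * ρ (suc n) + ρ (suc n)                 ∎
  where open ≡-Reasoning

ρ²-telescope : ∀ n → .{{ℕ.NonZero n}} → ρ (suc n) * ρ (suc n) + ρ (suc n) ≤ ρ n
ρ²-telescope n = ℚ.≤-trans
  (ℚ.+-monoˡ-≤ (ρ (suc n)) (*-monoʳ (ρ (suc n)) (0≤ρ (suc n)) ρ-antitone))
  (ℚ.≤-reflexive (sym (ρ-telescope n)))
  where
  ρ-antitone : ρ (suc n) ≤ ρ n
  ρ-antitone = ≤-from-sub (*-nonneg (0≤ρ n) (0≤ρ (suc n)))
    (trans (ℚ.+-comm (ρ (suc n)) _) (sym (ρ-telescope n)))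

-- Telescoping with 1/(n+1)² ≤ 1/n - 1/(n+1). The last term `ρ (y ℕ.+ m)` is kept on the left
-- because the next step of the induction consumes it.
∑ρ² : ∀ y → .{{ℕ.NonZero y}} → ∀ m → ∑ m (λ j → ρ (y ℕ.+ j) * ρ (y ℕ.+ j)) + ρ (y ℕ.+ m) ≤ ρ y
∑ρ² y zero    = ℚ.≤-reflexive (trans (ℚ.+-identityˡ _) (cong ρ (ℕ.+-identityʳ y)))
∑ρ² y (suc m) = begin
  ∑ m square + square (suc m) + ρ (y ℕ.+ suc m)
    ≡⟨ ℚ.+-assoc (∑ m square) _ _ ⟩
  ∑ m square + (square (suc m) + ρ (y ℕ.+ suc m))
    ≡⟨ cong (λ k → ∑ m square + (ρ k * ρ k + ρ k)) (ℕ.+-suc y m) ⟩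
  ∑ m square + (ρ (suc (y ℕ.+ m)) * ρ (suc (y ℕ.+ m)) + ρ (suc (y ℕ.+ m)))
    ≤⟨ ℚ.+-monoʳ-≤ (∑ m square) (ρ²-telescope (y ℕ.+ m) {{y+m≢0}}) ⟩
  ∑ m square + ρ (y ℕ.+ m)
    ≤⟨ ∑ρ² y m ⟩
  ρ y ∎
  where
  open ℚ.≤-Reasoning
  square : ℕ → ℚ
  square j = ρ (y ℕ.+ j) * ρ (y ℕ.+ j)

  y+m≢0 : ℕ.NonZero (y ℕ.+ m)
  y+m≢0 = ℕ.>-nonZero (ℕ.≤-trans (ℕ.>-nonZero⁻¹ y) (ℕ.m≤m+n y m))

-- Counting tuples

indicator : ∀ {A : Set} {P : Pred A 0ℓ} → Decidable P → A → ℚ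
indicator P? a = ι (bit (P? a))

sumℚ-++ : ∀ xs ys → sumℚ (xs ++ ys) ≡ sumℚ xs + sumℚ ys
sumℚ-++ []       ys = sym (ℚ.+-identityˡ (sumℚ ys))
sumℚ-++ (x ∷ xs) ys = trans (cong (x +_) (sumℚ-++ xs ys)) (sym (ℚ.+-assoc x _ _))

length-filter : ∀ {A : Set} {P : Pred A 0ℓ} (P? : Decidable P) → ∀ xs →
  ι (length (filter P? xs)) ≡ sumℚ (map (indicator P?) xs)
length-filter P? []       = refl
length-filter P? (x ∷ xs) with P? x
... | yes _ = trans (ι-suc (length (filter P? xs))) (cong (1ℚ +_) (length-filter P? xs))
... | no _  = trans (length-filter P? xs) (sym (ℚ.+-identityˡ _))

sumℚ-applyUpTo : ∀ h n → sumℚ (map h (applyUpTo suc n)) ≡ ∑ n h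
sumℚ-applyUpTo h zero    = refl
sumℚ-applyUpTo h (suc n) = begin
  sumℚ (map h (applyUpTo suc (suc n)))
    ≡⟨ cong (λ l → sumℚ (map h l)) (sym (applyUpTo-∷ʳ suc n)) ⟩
  sumℚ (map h (applyUpTo suc n ++ suc n ∷ []))        ≡⟨ cong sumℚ (map-++ h (applyUpTo suc n) _) ⟩
  sumℚ (map h (applyUpTo suc n) ++ h (suc n) ∷ [])    ≡⟨ sumℚ-++ (map h (applyUpTo suc n)) _ ⟩
  sumℚ (map h (applyUpTo suc n)) + (h (suc n) + 0ℚ)
    ≡⟨ cong₂ _+_ (sumℚ-applyUpTo h n) (ℚ.+-identityʳ _) ⟩
  ∑ n h + h (suc n)                                   ∎
  where open ≡-Reasoning

sumℚ-product : ∀ {X Y Z : Set} (f : X → Y → Z) (g : Z → ℚ) xs ys →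
  sumℚ (map g (cartesianProductWith f xs ys)) ≡ sumℚ (map (λ x → sumℚ (map (λ y → g (f x y)) ys)) xs)
sumℚ-product f g []       ys = refl
sumℚ-product f g (x ∷ xs) ys = begin
  sumℚ (map g (map (f x) ys ++ rest))
    ≡⟨ cong sumℚ (map-++ g (map (f x) ys) rest) ⟩
  sumℚ (map g (map (f x) ys) ++ map g rest)
    ≡⟨ sumℚ-++ (map g (map (f x) ys)) (map g rest) ⟩
  sumℚ (map g (map (f x) ys)) + sumℚ (map g rest)
    ≡⟨ cong₂ _+_ (cong sumℚ (sym (map-∘ ys))) (sumℚ-product f g xs ys) ⟩
  sumℚ (map (λ y → g (f x y)) ys) + sumℚ (map (λ x → sumℚ (map (λ y → g (f x y)) ys)) xs) ∎
  where
  open ≡-Reasoning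
  rest = cartesianProductWith f xs ys

sumℚ-tuples : ∀ s n → .{{ℕ.NonZero n}} → ∀ g →
  ρ (n ℕ.^ s) * sumℚ (map g (tuples s n)) ≡ mean s n g
sumℚ-tuples zero    n g = trans (ℚ.*-identityˡ _) (ℚ.+-identityʳ (g []))
sumℚ-tuples (suc s) n g = begin
  ρ (n ℕ.* n ℕ.^ s) * sumℚ (map g (tuples (suc s) n))
    ≡⟨ cong₂ _*_ (ρ-* n (n ℕ.^ s)) (trans (sumℚ-product _∷_ g (applyUpTo suc n) (tuples s n))
         (sumℚ-applyUpTo _ n)) ⟩
  ρ n * ρ (n ℕ.^ s) * ∑ n (λ a → sumℚ (map (λ as → g (a ∷ as)) (tuples s n)))
    ≡⟨ ℚ.*-assoc (ρ n) _ _ ⟩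
  ρ n * (ρ (n ℕ.^ s) * ∑ n (λ a → sumℚ (map (λ as → g (a ∷ as)) (tuples s n))))
    ≡⟨ cong (ρ n *_) (sym (∑-*ˡ (ρ (n ℕ.^ s)) _ n)) ⟩
  ρ n * ∑ n (λ a → ρ (n ℕ.^ s) * sumℚ (map (λ as → g (a ∷ as)) (tuples s n)))
    ≡⟨ cong (ρ n *_) (∑-cong n λ a → sumℚ-tuples s n (λ as → g (a ∷ as))) ⟩
  avg n (λ a → mean s n (λ as → g (a ∷ as))) ∎
  where open ≡-Reasoning

proportion≡mean : ∀ {P : Pred (Vec ℕ s) 0ℓ} (P? : Decidable P) n → .{{_ : ℕ.NonZero n}} →
  proportion s (count P? n) n ≡ mean s n (indicator P?)
proportion≡mean {s} P? n = begin
  proportion s (count P? n) n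
    ≡⟨ /≡ι*ρ (count P? n) (n ℕ.^ s) {{ℕ.m^n≢0 n s}} ⟩
  ι (count P? n) * ρ (n ℕ.^ s)
    ≡⟨ ℚ.*-comm (ι (count P? n)) (ρ (n ℕ.^ s)) ⟩
  ρ (n ℕ.^ s) * ι (count P? n)
    ≡⟨ cong (ρ (n ℕ.^ s) *_) (length-filter P? (tuples s n)) ⟩
  ρ (n ℕ.^ s) * sumℚ (map (indicator P?) (tuples s n))
    ≡⟨ sumℚ-tuples s n (indicator P?) ⟩
  mean s n (indicator P?) ∎
  where open ≡-Reasoning

-- Comparison of the sieve with the property itself

hits≡0 : ∀ p n (as : Vec ℕ s) → All (InRange n) as → n ℕ.< p → hits p as ≡ 0
hits≡0 p n []       []               n<p = refl
hits≡0 p n (a ∷ as) ((1≤a , a≤n) ∷ r) n<p = cong₂ ℕ._+_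
  (bit-no (p ∣? a) (>⇒∤ {{ℕ.>-nonZero 1≤a}} (ℕ.≤-<-trans a≤n n<p))) (hits≡0 p n as r n<p)

sieve-cases : ∀ N τ (as : Vec ℕ s) →
  sieve N τ as ≡ 0ℚ ⊎ (sieve N τ as ≡ 1ℚ × (∀ p → Prime p → p ℕ.< N → hits p as ℕ.< τ p))
sieve-cases zero    τ as = inj₂ (refl , λ _ _ ())
sieve-cases (suc N) τ as with sieve-cases N τ as
... | inj₁ eq = inj₁ (trans (cong (_* factor) eq) (ℚ.*-zeroˡ factor))
  where factor = ifDec (prime? N) (χ (hits N as) (τ N))
... | inj₂ (eq , below) with prime? N
...   | no ¬pr = inj₂ (trans (ℚ.*-identityʳ _) eq , λ p pr p<1+N →
          below p pr (ℕ.≤∧≢⇒< (ℕ.≤-pred p<1+N) λ { refl → ¬pr pr }))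
...   | yes _ with χ-cases (hits N as) (τ N)
...     | inj₁ (χ≡0 , _) = inj₁ (trans (cong (sieve N τ as *_) χ≡0) (ℚ.*-zeroʳ (sieve N τ as)))
...     | inj₂ (χ≡1 , h<τ) = inj₂ (cong₂ _*_ eq χ≡1 , λ p pr p<1+N →
          below′ p pr (ℕ.m≤n⇒m<n∨m≡n (ℕ.≤-pred p<1+N)))
  where
  below′ : ∀ p → Prime p → p ℕ.< N ⊎ p ≡ N → hits p as ℕ.< τ p
  below′ p pr (inj₁ p<N)  = below p pr p<N
  below′ p pr (inj₂ refl) = h<τ

sieve≤1 : ∀ N τ (as : Vec ℕ s) → sieve N τ as ≤ 1ℚ
sieve≤1 N τ as with sieve-cases N τ as
... | inj₁ eq       = subst (_≤ 1ℚ) (sym eq) 0≤1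
... | inj₂ (eq , _) = ℚ.≤-reflexive eq

0≤sieve : ∀ N τ (as : Vec ℕ s) → 0ℚ ≤ sieve N τ as
0≤sieve N τ as with sieve-cases N τ as
... | inj₁ eq       = ℚ.≤-reflexive (sym eq)
... | inj₂ (eq , _) = subst (0ℚ ≤_) (sym eq) 0≤1

sieve≡1 : ∀ N τ (as : Vec ℕ s) → (∀ p → Prime p → hits p as ℕ.< τ p) → sieve N τ as ≡ 1ℚ
sieve≡1 N τ as below = trans (∏-cong N λ p _ → factor p) (∏-1 N)
  where
  factor : ∀ p → ifDec (prime? p) (χ (hits p as) (τ p)) ≡ 1ℚ
  factor p with prime? p
  ... | no _ = refl
  ... | yes pr with χ-cases (hits p as) (τ p)
  ...   | inj₁ (_ , τ≤h) = contradiction τ≤h (ℕ.<⇒≱ (below p pr))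
  ...   | inj₂ (eq , _)  = eq

-- All integers above y take part, not only primes: this can only enlarge an upper bound, and
-- telescoping wants consecutive integers.
tail : ℕ → ℕ → Vec ℕ s → ℚ
tail y m as = ∑ m (λ j → hitPairs (y ℕ.+ j) as)

0≤tail : ∀ y m (as : Vec ℕ s) → 0ℚ ≤ tail y m as
0≤tail y m as = ∑-nonneg m λ j → 0≤hitPairs (y ℕ.+ j) as

tail-cases : ∀ y m (as : Vec ℕ s) →
  1ℚ ≤ tail y m as ⊎ (∀ j → 1 ℕ.≤ j → j ℕ.≤ m → hits (y ℕ.+ j) as ℕ.< 2)
tail-cases y zero    as = inj₂ λ { (suc _) _ () }
tail-cases y (suc m) as with tail-cases y m as
... | inj₁ 1≤ = inj₁ (ℚ.+-mono-≤ 1≤ (0≤hitPairs (y ℕ.+ suc m) as))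
... | inj₂ few with 2 ℕ.≤? hits (y ℕ.+ suc m) as
...   | yes 2≤ = inj₁ (ℚ.+-mono-≤ (0≤tail y m as) (1≤hitPairs (y ℕ.+ suc m) as 2≤))
...   | no 2≰  = inj₂ λ j 1≤j j≤1+m → few′ j 1≤j (ℕ.m≤n⇒m<n∨m≡n j≤1+m)
  where
  few′ : ∀ j → 1 ℕ.≤ j → j ℕ.< suc m ⊎ j ≡ suc m → hits (y ℕ.+ j) as ℕ.< 2
  few′ j 1≤j (inj₁ j<1+m) = few j 1≤j (ℕ.≤-pred j<1+m)
  few′ j 1≤j (inj₂ refl)  = ℕ.≰⇒> 2≰

mean-tail : ∀ s n → .{{ℕ.NonZero n}} → ∀ y → .{{ℕ.NonZero y}} → ∀ m →
  mean s n (tail y m) ≤ ι (s C 2) * ρ y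
mean-tail s n y m = begin
  mean s n (tail y m)
    ≡⟨ mean-∑ s n m (λ j → hitPairs (y ℕ.+ j)) ⟩
  ∑ m (λ j → mean s n (hitPairs (y ℕ.+ j)))
    ≤⟨ ∑-mono m (λ j _ _ → mean-hitPairs s n (y ℕ.+ j) {{y+j≢0 j}}) ⟩
  ∑ m (λ j → ι (s C 2) * (ρ (y ℕ.+ j) * ρ (y ℕ.+ j)))
    ≡⟨ ∑-*ˡ (ι (s C 2)) _ m ⟩
  ι (s C 2) * ∑ m (λ j → ρ (y ℕ.+ j) * ρ (y ℕ.+ j))
    ≤⟨ *-monoˡ (ι (s C 2)) (0≤ι (s C 2)) (≤-from-sub (0≤ρ (y ℕ.+ m)) refl) ⟩
  ι (s C 2) * (∑ m (λ j → ρ (y ℕ.+ j) * ρ (y ℕ.+ j)) + ρ (y ℕ.+ m))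
    ≤⟨ *-monoˡ (ι (s C 2)) (0≤ι (s C 2)) (∑ρ² y m) ⟩
  ι (s C 2) * ρ y ∎
  where
  open ℚ.≤-Reasoning
  y+j≢0 : ∀ j → ℕ.NonZero (y ℕ.+ j)
  y+j≢0 j = ℕ.>-nonZero (ℕ.≤-trans (ℕ.>-nonZero⁻¹ y) (ℕ.m≤m+n y j))

-- The bound `τ≥1` settles the primes too large to divide any entry. By `τ≥2` a violation at a prime
-- between these and y takes two hits, which the tail detects.
module Sandwich {P : Pred (Vec ℕ s) 0ℓ} (P? : Decidable P) (τ : ℕ → ℕ) (y₀ : ℕ)
  (τ≥1 : ∀ p → 1 ℕ.≤ τ p) (τ≥2 : ∀ p → y₀ ℕ.< p → 2 ℕ.≤ τ p)
  (sound    : ∀ as → P as → ∀ p → Prime p → hits p as ℕ.< τ p)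
  (complete : ∀ as → (∀ p → Prime p → hits p as ℕ.< τ p) → P as) where

  indicator≤sieve : ∀ N as → indicator P? as ≤ sieve N τ as
  indicator≤sieve N as with P? as
  ... | yes Pas = ℚ.≤-reflexive (sym (sieve≡1 N τ as (sound as Pas)))
  ... | no _    = 0≤sieve N τ as

  -- The tail runs over y < d ≤ y + n and so covers every prime p > y that can
  -- divide an entry.
  sieve≤indicator+tail : ∀ y → y₀ ℕ.≤ y → ∀ n as → All (InRange n) as →
    sieve (suc y) τ as ≤ indicator P? as + tail y n as
  sieve≤indicator+tail y y₀≤y n as r with P? as
  ... | yes _ = ℚ.≤-trans (sieve≤1 (suc y) τ as) (≤-from-sub (0≤tail y n as) refl)
  ... | no ¬P = subst (sieve (suc y) τ as ≤_) (sym (ℚ.+-identityˡ (tail y n as))) bound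
    where
    bound : sieve (suc y) τ as ≤ tail y n as
    bound with tail-cases y n as
    ... | inj₁ 1≤tail = ℚ.≤-trans (sieve≤1 (suc y) τ as) 1≤tail
    ... | inj₂ few with sieve-cases (suc y) τ as
    ...   | inj₁ eq = subst (_≤ tail y n as) (sym eq) (0≤tail y n as)
    ...   | inj₂ (_ , below) = contradiction (complete as all-below) ¬P
      where
      all-below : ∀ p → Prime p → hits p as ℕ.< τ p
      all-below p pr with p ℕ.≤? y | p ℕ.≤? y ℕ.+ n
      ... | yes p≤y | _       = below p pr (s≤s p≤y)
      ... | no p≰y  | no p≰y+n = subst (ℕ._< τ p)
        (sym (hits≡0 p n as r (ℕ.≤-<-trans (ℕ.m≤n+m n y) (ℕ.≰⇒> p≰y+n)))) (τ≥1 p)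
      ... | no p≰y  | yes p≤y+n = ℕ.<-≤-trans
        (subst (λ q → hits q as ℕ.< 2) (ℕ.m+[n∸m]≡n (ℕ.<⇒≤ y<p))
          (few (p ∸ y) (ℕ.m<n⇒0<n∸m y<p) (subst (p ∸ y ℕ.≤_) (ℕ.m+n∸m≡n y n) (ℕ.∸-monoˡ-≤ y p≤y+n))))
        (τ≥2 p (ℕ.≤-<-trans y₀≤y y<p))
        where y<p = ℕ.≰⇒> p≰y

  proportion-estimate : ∀ y → .{{ℕ.NonZero y}} → y₀ ℕ.≤ y → ∀ n → .{{_ : ℕ.NonZero n}} →
    ∣ proportion s (count P? n) n - density s (suc y) τ ∣
      ≤ ι (s C 2) * ρ y + ι (s ℕ.* 2 ℕ.^ suc y) * ρ n
  proportion-estimate y y₀≤y n = begin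
    ∣ proportion s (count P? n) n - density s (suc y) τ ∣
      ≡⟨ cong (λ e → ∣ e - density s (suc y) τ ∣) (proportion≡mean P? n) ⟩
    ∣ EP - density s (suc y) τ ∣
      ≤⟨ ∣-∣-triangle EP ES (density s (suc y) τ) ⟩
    ∣ EP - ES ∣ + ∣ ES - density s (suc y) τ ∣
      ≤⟨ ℚ.+-mono-≤ (∣p-q∣≤ EP ES EP≤ ES≤) (mean-sieve s (suc y) τ n) ⟩
    ι (s C 2) * ρ y + ι s * (ι (2 ℕ.^ suc y) * ρ n)
      ≡⟨ cong (ι (s C 2) * ρ y +_) (trans (sym (ℚ.*-assoc (ι s) _ (ρ n)))
           (cong (_* ρ n) (sym (ι-* s (2 ℕ.^ suc y))))) ⟩
    ι (s C 2) * ρ y + ι (s ℕ.* 2 ℕ.^ suc y) * ρ n ∎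
    where
    open ℚ.≤-Reasoning
    EP = mean s n (indicator P?)
    ES = mean s n (sieve (suc y) τ)

    EP≤ : EP ≤ ES + ι (s C 2) * ρ y
    EP≤ = ℚ.≤-trans (mean-mono s n λ as _ → indicator≤sieve (suc y) as)
      (≤-from-sub (*-nonneg (0≤ι (s C 2)) (0≤ρ y)) refl)

    ES≤ : ES ≤ EP + ι (s C 2) * ρ y
    ES≤ = begin
      ES                            ≤⟨ mean-mono s n (sieve≤indicator+tail y y₀≤y n) ⟩
      mean s n (λ as → indicator P? as + tail y n as)
                                    ≡⟨ mean-+ s n (indicator P?) (tail y n) ⟩
      EP + mean s n (tail y n)         ≤⟨ ℚ.+-monoʳ-≤ EP (mean-tail s n y n) ⟩
      EP + ι (s C 2) * ρ y          ∎

-- Limits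

0<½* : ∀ {ε} → 0ℚ < ε → 0ℚ < ½ * ε
0<½* {ε} 0<ε = subst (_< ½ * ε) (ℚ.*-zeroʳ ½) (ℚ.*-monoʳ-<-pos ½ 0<ε)

½*+½* : ∀ ε → ½ * ε + ½ * ε ≡ ε
½*+½* ε = trans (sym (ℚ.*-distribʳ-+ ε ½ ½)) (ℚ.*-identityˡ ε)

½*< : ∀ {ε} → 0ℚ < ε → ½ * ε < ε
½*< {ε} 0<ε = subst₂ _<_ (ℚ.+-identityˡ (½ * ε)) (½*+½* ε) (ℚ.+-monoˡ-< (½ * ε) (0<½* 0<ε))

-- N is chosen after y because the sieve error, of order 2^y / n, is not uniform in y.
IteratedLimit : (ℕ → ℚ) → (ℕ → ℚ) → Set
IteratedLimit x d = ∀ ε → 0ℚ < ε → ∃[ Y ] (∀ y → Y ℕ.≤ y →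
  ∃[ N ] (∀ n → N ℕ.≤ n → ∣ x n - d y ∣ ≤ ε))

-- Two late terms of d are both close to x n for one common large n. Quarters of ε are used, so that
-- the sum of two weak bounds is strictly below ε.
iteratedLimit⇒cauchy : ∀ x d → IteratedLimit x d → IsCauchy d
iteratedLimit⇒cauchy x d lim ε 0<ε with lim (½ * (½ * ε)) (0<½* (0<½* 0<ε))
... | Y , near = Y , close
  where
  open ℚ.≤-Reasoning
  close : ∀ y z → Y ℕ.≤ y → Y ℕ.≤ z → ∣ d y - d z ∣ < ε
  close y z Y≤y Y≤z with near y Y≤y | near z Y≤z
  ... | M , x≈dy | N , x≈dz = begin-strict
    ∣ d y - d z ∣                         ≤⟨ ∣-∣-triangle (d y) (x n) (d z) ⟩
    ∣ d y - x n ∣ + ∣ x n - d z ∣         ≡⟨ cong (_+ ∣ x n - d z ∣) (∣-∣-comm (d y) (x n)) ⟩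
    ∣ x n - d y ∣ + ∣ x n - d z ∣         ≤⟨ ℚ.+-mono-≤ (x≈dy n (ℕ.m≤m⊔n M N)) (x≈dz n (ℕ.m≤n⊔m M N)) ⟩
    ½ * (½ * ε) + ½ * (½ * ε)             ≡⟨ ½*+½* (½ * ε) ⟩
    ½ * ε                                 <⟨ ½*< 0<ε ⟩
    ε                                     ∎
    where n = M ℕ.⊔ N

-- Two quarters of ε cover the way from x n to one approximant of L and from there to all later
-- ones. The remaining half is the positive gap that `_<ᴿ_` demands.
iteratedLimit⇒⟶ : ∀ x L → IteratedLimit x (seq L) → x ⟶ L
iteratedLimit⇒⟶ x L lim ε 0<ε
  with lim (½ * (½ * ε)) (0<½* (0<½* 0<ε)) | cauchy L (½ * (½ * ε)) (0<½* (0<½* 0<ε))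
... | Y , near | M , close with near (Y ℕ.⊔ M) (ℕ.m≤m⊔n Y M)
...   | N , x≈ = N , λ n N≤n → ½ * ε , 0<½* 0<ε , M , λ m M≤m → begin
  ∣ x n - seq L m ∣ + ½ * ε
    ≤⟨ ℚ.+-monoˡ-≤ (½ * ε) (∣-∣-triangle (x n) (seq L y) (seq L m)) ⟩
  (∣ x n - seq L y ∣ + ∣ seq L y - seq L m ∣) + ½ * ε
    ≤⟨ ℚ.+-monoˡ-≤ (½ * ε) (ℚ.+-mono-≤ (x≈ n N≤n) (ℚ.<⇒≤ (close y m (ℕ.m≤n⊔m Y M) M≤m))) ⟩
  (½ * (½ * ε) + ½ * (½ * ε)) + ½ * ε
    ≡⟨ cong (_+ ½ * ε) (½*+½* (½ * ε)) ⟩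
  ½ * ε + ½ * ε
    ≡⟨ ½*+½* ε ⟩
  ε ∎
  where
  open ℚ.≤-Reasoning
  y = Y ℕ.⊔ M

seq⟶ : ∀ L → seq L ⟶ L
seq⟶ L ε 0<ε with cauchy L (½ * ε) (0<½* 0<ε)
... | N , close = N , λ n N≤n → ½ * ε , 0<½* 0<ε , N , λ m N≤m → ℚ.≤-trans
  (ℚ.+-monoˡ-≤ (½ * ε) (ℚ.<⇒≤ (close n m N≤n N≤m))) (ℚ.≤-reflexive (½*+½* ε))

estimate⇒iteratedLimit : ∀ (c : ℕ) (K : ℕ → ℕ) y₀ x d →
  (∀ y → .{{ℕ.NonZero y}} → y₀ ℕ.≤ y → ∀ n → ∣ x n - d y ∣ ≤ ι c * ρ y + ι (K y) * ρ (suc n)) →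
  IteratedLimit x d
estimate⇒iteratedLimit c K y₀ x d estimate ε 0<ε with archimedean c (½ * ε) (0<½* 0<ε)
-- The `suc` keeps y away from 0, where `ρ y` has its junk value.
... | Y , c/y≤ = Y ℕ.⊔ suc y₀ , near
  where
  near : ∀ y → Y ℕ.⊔ suc y₀ ℕ.≤ y → ∃[ N ] (∀ n → N ℕ.≤ n → ∣ x n - d y ∣ ≤ ε)
  near y@(suc _) ≤y with archimedean (K y) (½ * ε) (0<½* 0<ε)
  ... | N , K/n≤ = N , λ n N≤n → ℚ.≤-trans (estimate y y₀≤y n) (ℚ.≤-trans
    (ℚ.+-mono-≤ (c/y≤ y (ℕ.m⊔n≤o⇒m≤o Y (suc y₀) ≤y)) (K/n≤ (suc n) (ℕ.m≤n⇒m≤1+n N≤n)))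
    (ℚ.≤-reflexive (½*+½* ε)))
    where
    y₀≤y : y₀ ℕ.≤ y
    y₀≤y = ℕ.<⇒≤ (ℕ.m⊔n≤o⇒n≤o Y (suc y₀) ≤y)
  near zero ≤y = contradiction (ℕ.m⊔n≤o⇒n≤o Y (suc y₀) ≤y) λ ()

-- Local factors

∑₀ : (ℕ → ℚ) → ℕ → ℚ
∑₀ h zero    = 0ℚ
∑₀ h (suc n) = ∑₀ h n + h n

∑₀-cong : ∀ {h g} n → (∀ a → a ℕ.< n → h a ≡ g a) → ∑₀ h n ≡ ∑₀ g n
∑₀-cong zero    eq = refl
∑₀-cong (suc n) eq = cong₂ _+_ (∑₀-cong n λ a a<n → eq a (ℕ.m<n⇒m<1+n a<n)) (eq n ℕ.≤-refl)

∑₀-*ˡ : ∀ c h n → ∑₀ (λ a → c * h a) n ≡ c * ∑₀ h n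
∑₀-*ˡ c h zero    = sym (ℚ.*-zeroʳ c)
∑₀-*ˡ c h (suc n) = trans (cong (_+ c * h n) (∑₀-*ˡ c h n)) (sym (ℚ.*-distribˡ-+ c (∑₀ h n) (h n)))

∑₀-sumℚ : ∀ h n → sumℚ (applyUpTo h n) ≡ ∑₀ h n
∑₀-sumℚ h zero    = refl
∑₀-sumℚ h (suc n) = trans (cong sumℚ (sym (applyUpTo-∷ʳ h n)))
  (trans (sumℚ-++ (applyUpTo h n) _) (cong₂ _+_ (∑₀-sumℚ h n) (ℚ.+-identityʳ (h n))))

ι-sum : ∀ xs → ι (sum xs) ≡ sumℚ (map ι xs)
ι-sum []       = refl
ι-sum (x ∷ xs) = trans (ι-+ x (sum xs)) (cong (ι x +_) (ι-sum xs))

1^ : ∀ n → 1ℚ ^ n ≡ 1ℚ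
1^ zero    = refl
1^ (suc n) = trans (ℚ.*-identityˡ (1ℚ ^ n)) (1^ n)

^-distrib-+ : ∀ x m n → x ^ (m ℕ.+ n) ≡ x ^ m * x ^ n
^-distrib-+ x zero    n = sym (ℚ.*-identityˡ (x ^ n))
^-distrib-+ x (suc m) n = trans (cong (x *_) (^-distrib-+ x m n)) (sym (ℚ.*-assoc x (x ^ m) (x ^ n)))

-- Used at (1 - 1/p, 1/p) for `factorA` and at (p - 1, 1) for `binomSum`. The second pair is p times
-- the first, which `binomialCDF-homogeneous` exploits.
module Binomial (x y : ℚ) where

  -- T s t is the sum over m < t of C(s, m) x^(t-1-m) y^m.
  T : ℕ → ℕ → ℚ
  T s zero    = 0ℚ
  T s (suc t) = x * T s t + ι (s C t) * y ^ t

  -- Up to the powers of x in `cdf-closed`, this is the recursion of `binomialCDF`; Pascal's rule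
  -- gives it coefficient by coefficient.
  T-pascal : ∀ s t → T (suc s) (suc t) ≡ T s (suc t) + y * T s t
  T-pascal s zero    = solve 2 (λ x y →
    x :* con 0ℚ :+ con 1ℚ :* con 1ℚ := x :* con 0ℚ :+ con 1ℚ :* con 1ℚ :+ y :* con 0ℚ) refl x y
  T-pascal s (suc t) = begin
    x * T (suc s) (suc t) + ι (suc s C suc t) * y ^ suc t
      ≡⟨ cong₂ (λ a b → x * a + b * y ^ suc t) (T-pascal s t)
           (trans (cong ι (sym (nCk+nC[k+1]≡[n+1]C[k+1] s t))) (ι-+ (s C t) (s C suc t))) ⟩
    x * (T s (suc t) + y * T s t) + (ι (s C t) + ι (s C suc t)) * (y * y ^ t)
      ≡⟨ solve 7 (λ x y a b c d z →
           x :* (a :+ y :* b) :+ (c :+ d) :* (y :* z)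
           := x :* a :+ d :* (y :* z) :+ y :* (x :* b :+ c :* z)) refl
           x y (T s (suc t)) (T s t) (ι (s C t)) (ι (s C suc t)) (y ^ t) ⟩
    T s (suc (suc t)) + y * T s (suc t) ∎
    where open ≡-Reasoning

  T-zero : ∀ t → T 0 (suc t) ≡ x ^ t
  T-zero zero    = solve 1 (λ x → x :* con 0ℚ :+ con 1ℚ :* con 1ℚ := con 1ℚ) refl x
  T-zero (suc t) = trans
    (cong₂ (λ a b → x * a + ι b * y ^ suc t) (T-zero t) (k>n⇒nCk≡0 {0} {suc t} (s≤s z≤n)))
    (solve 2 (λ a b → a :+ con 0ℚ :* b := a) refl (x * x ^ t) (y ^ suc t))

  cdf : ℕ → ℕ → ℚ
  cdf = binomialCDF x y

  cdf-0 : ∀ s → cdf s 0 ≡ 0ℚ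
  cdf-0 zero    = refl
  cdf-0 (suc s) = trans (cong (λ c → x * c + y * c) (cdf-0 s))
    (solve 2 (λ x y → x :* con 0ℚ :+ y :* con 0ℚ := con 0ℚ) refl x y)

  -- Multiplied by x ^ t, since x ^ (s + 1 - t) may have a negative exponent.
  cdf-closed : ∀ s t → x ^ t * cdf s t ≡ x ^ suc s * T s t
  cdf-closed s zero = trans (cong (1ℚ *_) (cdf-0 s)) (sym (ℚ.*-zeroʳ (x ^ suc s)))
  cdf-closed zero (suc t) = begin
    x * x ^ t * 1ℚ
      ≡⟨ solve 2 (λ x z → x :* z :* con 1ℚ := x :* con 1ℚ :* z) refl x (x ^ t) ⟩
    x * 1ℚ * x ^ t              ≡⟨ cong (x * 1ℚ *_) (sym (T-zero t)) ⟩
    x * 1ℚ * T 0 (suc t)        ∎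
    where open ≡-Reasoning
  cdf-closed (suc s) (suc t) = begin
    x * x ^ t * (x * cdf s (suc t) + y * cdf s t)
      ≡⟨ solve 5 (λ x y z a b → x :* z :* (x :* a :+ y :* b) := x :* (x :* z :* a) :+ x :* y :* (z :* b)) refl
           x y (x ^ t) (cdf s (suc t)) (cdf s t) ⟩
    x * (x * x ^ t * cdf s (suc t)) + x * y * (x ^ t * cdf s t)
      ≡⟨ cong₂ (λ a b → x * a + x * y * b) (cdf-closed s (suc t)) (cdf-closed s t) ⟩
    x * (x ^ suc s * T s (suc t)) + x * y * (x ^ suc s * T s t)
      ≡⟨ solve 5 (λ x y z a b → x :* (z :* a) :+ x :* y :* (z :* b) := x :* z :* (a :+ y :* b)) refl
           x y (x ^ suc s) (T s (suc t)) (T s t) ⟩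
    x * x ^ suc s * (T s (suc t) + y * T s t)
      ≡⟨ cong (x * x ^ suc s *_) (sym (T-pascal s t)) ⟩
    x * x ^ suc s * T (suc s) (suc t) ∎
    where open ≡-Reasoning

  -- Cutting the sum at m = i isolates the numerator in `f`. At i = 0 the first summand vanishes and
  -- `T` appears as an explicit sum.
  T-split : ∀ s i j →
    T s (i ℕ.+ j) ≡ x ^ j * T s i + ∑₀ (λ m → ι (s C (i ℕ.+ m)) * x ^ (j ∸ 1 ∸ m) * y ^ (i ℕ.+ m)) j
  T-split s i zero    = trans (cong (T s) (ℕ.+-identityʳ i))
    (solve 1 (λ t → t := con 1ℚ :* t :+ con 0ℚ) refl (T s i))
  T-split s i (suc j) = begin
    T s (i ℕ.+ suc j)
      ≡⟨ cong (T s) (ℕ.+-suc i j) ⟩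
    x * T s (i ℕ.+ j) + c
      ≡⟨ cong (λ t → x * t + c) (T-split s i j) ⟩
    x * (x ^ j * T s i + ∑₀ (h (j ∸ 1)) j) + c
      ≡⟨ solve 5 (λ x z t r c → x :* (z :* t :+ r) :+ c := x :* z :* t :+ (x :* r :+ c)) refl
           x (x ^ j) (T s i) (∑₀ (h (j ∸ 1)) j) c ⟩
    x ^ suc j * T s i + (x * ∑₀ (h (j ∸ 1)) j + c)
      ≡⟨ cong (x ^ suc j * T s i +_) (cong₂ _+_
           (trans (sym (∑₀-*ˡ x (h (j ∸ 1)) j)) (∑₀-cong j λ m m<j → raise m m<j)) last) ⟩
    x ^ suc j * T s i + (∑₀ (h j) j + h j j) ∎
    where
    open ≡-Reasoning
    h : ℕ → ℕ → ℚ
    h d m = ι (s C (i ℕ.+ m)) * x ^ (d ∸ m) * y ^ (i ℕ.+ m)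

    c = ι (s C (i ℕ.+ j)) * y ^ (i ℕ.+ j)

    last : c ≡ h j j
    last = trans
      (solve 2 (λ a b → a :* b := a :* con 1ℚ :* b) refl (ι (s C (i ℕ.+ j))) (y ^ (i ℕ.+ j)))
      (cong (λ d → ι (s C (i ℕ.+ j)) * x ^ d * y ^ (i ℕ.+ j)) (sym (ℕ.n∸n≡0 j)))

    1+j∸1∸m : ∀ j m → m ℕ.< j → suc (j ∸ 1 ∸ m) ≡ j ∸ m
    1+j∸1∸m (suc j) m (s≤s m≤j) = sym (ℕ.+-∸-assoc 1 m≤j)

    raise : ∀ m → m ℕ.< j → x * h (j ∸ 1) m ≡ h j m
    raise m m<j = trans
      (solve 4 (λ x a z b → x :* (a :* z :* b) := a :* (x :* z) :* b) refl
        x (ι (s C (i ℕ.+ m))) (x ^ (j ∸ 1 ∸ m)) (y ^ (i ℕ.+ m)))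
      (cong (λ d → ι (s C (i ℕ.+ m)) * x ^ d * y ^ (i ℕ.+ m)) (1+j∸1∸m j m m<j))

binomialCDF-homogeneous : ∀ c x y s t →
  binomialCDF (c * x) (c * y) s t ≡ c ^ s * binomialCDF x y s t
binomialCDF-homogeneous c x y zero    t = sym (ℚ.*-identityˡ (χ 0 t))
binomialCDF-homogeneous c x y (suc s) t = trans
  (cong₂ (λ a b → c * x * a + c * y * b)
    (binomialCDF-homogeneous c x y s t) (binomialCDF-homogeneous c x y s (t ∸ 1)))
  (solve 6 (λ c x y z a b → c :* x :* (z :* a) :+ c :* y :* (z :* b) := c :* z :* (x :* a :+ y :* b)) refl
    c x y (c ^ s) (binomialCDF x y s t) (binomialCDF x y s (t ∸ 1)))

*-cancelˡ : ∀ r .{{_ : NonZero r}} {p q} → r * p ≡ r * q → p ≡ q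
*-cancelˡ r {p} {q} eq = trans (sym (undo p)) (trans (cong (1/ r *_) eq) (undo q))
  where
  undo : ∀ p → 1/ r * (r * p) ≡ p
  undo p = trans (sym (ℚ.*-assoc (1/ r) r p)) (trans (cong (_* p) (ℚ.*-inverseˡ r)) (ℚ.*-identityˡ p))

^-cancelˡ : ∀ r .{{_ : NonZero r}} n {p q} → r ^ n * p ≡ r ^ n * q → p ≡ q
^-cancelˡ r zero {p} {q} eq = trans (sym (ℚ.*-identityˡ p)) (trans eq (ℚ.*-identityˡ q))
^-cancelˡ r (suc n) {p} {q} eq = ^-cancelˡ r n (*-cancelˡ r
  (trans (sym (ℚ.*-assoc r (r ^ n) p)) (trans eq (ℚ.*-assoc r (r ^ n) q))))

-- Clears the exponent s - k + 1 of `factorA`, which is `suc s ⊖ k` and may be negative.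
^-^ᶻ : ∀ q .{{_ : NonZero q}} m n → q ^ n * q ^ᶻ (m ⊖ n) ≡ q ^ m
^-^ᶻ q m       zero    = ℚ.*-identityˡ (q ^ m)
^-^ᶻ q zero    (suc n) = trans (cong (q ^ suc n *_) refl) (inverse (suc n))
  where
  inverse : ∀ n → q ^ n * (1/ q) ^ n ≡ 1ℚ
  inverse zero    = refl
  inverse (suc n) = trans
    (solve 4 (λ a b c d → a :* b :* (c :* d) := a :* c :* (b :* d)) refl q (q ^ n) (1/ q) ((1/ q) ^ n))
    (cong₂ _*_ (ℚ.*-inverseʳ q) (inverse n))
^-^ᶻ q (suc m) (suc n) = trans (cong (λ z → q ^ suc n * q ^ᶻ z) (ℤ.[1+m]⊖[1+n]≡m⊖n m n))
  (trans (ℚ.*-assoc q (q ^ n) _) (cong (q *_) (^-^ᶻ q m n)))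

-- The factor of A at p is the probability that fewer than k of s independent events of probability
-- 1/p occur. After multiplication by q^k this is `cdf-closed`.
factorA≡localDensity : ∀ s t p → .{{_ : ℕ.NonTrivial p}} →
  factorA s (suc t) p ≡ localDensity s p (suc t)
factorA≡localDensity s t p@(suc p′) = ^-cancelˡ q {{q≢0}} (suc t) (begin
  q ^ suc t * (q ^ᶻ (ℤ.+ s ℤ.- ℤ.+ suc t ℤ.+ ℤ.1ℤ) * S)
    ≡⟨ cong₂ (λ z S → q ^ suc t * (q ^ᶻ z * S)) exponent S≡T ⟩
  q ^ suc t * (q ^ᶻ (suc s ⊖ suc t) * T s (suc t))
    ≡⟨ sym (ℚ.*-assoc (q ^ suc t) _ (T s (suc t))) ⟩
  q ^ suc t * q ^ᶻ (suc s ⊖ suc t) * T s (suc t)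
    ≡⟨ cong (_* T s (suc t)) (^-^ᶻ q {{q≢0}} (suc s) (suc t)) ⟩
  q ^ suc s * T s (suc t)
    ≡⟨ sym (cdf-closed s (suc t)) ⟩
  q ^ suc t * localDensity s p (suc t) ∎)
  where
  open ≡-Reasoning
  q = 1ℚ - ρ p
  instance
    q≢0 : NonZero q
    q≢0 = 1-inv≢0 p
  open Binomial q (ρ p)

  summand : ℕ → ℚ
  summand m = ι (s C m) * q ^ (t ∸ m) * ρ p ^ m

  S = sumℚ (map summand (applyUpTo (λ m → m) (suc t)))

  S≡T : S ≡ T s (suc t)
  S≡T = trans (cong sumℚ (map-applyUpTo (λ m → m) summand (suc t))) (trans (∑₀-sumℚ summand (suc t))
    (trans (solve 2 (λ z a → a := z :* con 0ℚ :+ a) refl (q ^ suc t) (∑₀ summand (suc t)))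
      (sym (T-split s 0 (suc t)))))

  exponent : ℤ.+ s ℤ.- ℤ.+ suc t ℤ.+ ℤ.1ℤ ≡ suc s ⊖ suc t
  exponent = begin
    ℤ.+ s ℤ.- ℤ.+ suc t ℤ.+ ℤ.1ℤ     ≡⟨ ℤ.+-comm (ℤ.+ s ℤ.- ℤ.+ suc t) ℤ.1ℤ ⟩
    ℤ.1ℤ ℤ.+ (ℤ.+ s ℤ.- ℤ.+ suc t)   ≡⟨ sym (ℤ.+-assoc ℤ.1ℤ (ℤ.+ s) (ℤ.- ℤ.+ suc t)) ⟩
    ℤ.+ suc s ℤ.- ℤ.+ suc t          ≡⟨ ℤ.m-n≡m⊖n (suc s) (suc t) ⟩
    suc s ⊖ suc t                    ∎

-- At y = 1 the powers of y disappear and x = p - 1 makes every summand a natural number.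
binomSum-split : ∀ s p i j → let open Binomial (ι (p ∸ 1)) 1ℚ in .{{ℕ.NonZero (i ℕ.+ j)}} →
  T s (i ℕ.+ j) ≡ ι (p ∸ 1) ^ j * T s i + ι (binomSum s (i ℕ.+ j) i p)
binomSum-split s p i j = trans (T-split s i j) (cong (X ^ j * T s i +_) (begin
  ∑₀ (λ m → ι (s C (i ℕ.+ m)) * X ^ (j ∸ 1 ∸ m) * 1ℚ ^ (i ℕ.+ m)) j
    ≡⟨ ∑₀-cong j summand≡ ⟩
  ∑₀ (λ m → ι (h (i ℕ.+ m))) j
    ≡⟨ sym (∑₀-sumℚ _ j) ⟩
  sumℚ (applyUpTo (λ m → ι (h (i ℕ.+ m))) j)
    ≡⟨ cong sumℚ (sym (trans (cong (map ι) (map-applyUpTo (i ℕ.+_) h j)) (map-applyUpTo _ ι j))) ⟩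
  sumℚ (map ι (map h (applyUpTo (i ℕ.+_) j)))
    ≡⟨ sym (ι-sum (map h (applyUpTo (i ℕ.+_) j))) ⟩
  ι (sum (map h (applyUpTo (i ℕ.+_) j)))
    ≡⟨ cong (λ l → ι (sum (map h (applyUpTo (i ℕ.+_) l)))) (sym range) ⟩
  ι (binomSum s (i ℕ.+ j) i p) ∎))
  where
  open ≡-Reasoning
  open Binomial (ι (p ∸ 1)) 1ℚ
  X = ι (p ∸ 1)
  h : ℕ → ℕ
  h m = (s C m) ℕ.* (p ∸ 1) ℕ.^ (i ℕ.+ j ∸ 1 ∸ m)

  -- Here i + j must be nonzero: otherwise truncation in `k ∸ 1` would leave one index in an
  -- interval that ought to be empty.
  range : suc (i ℕ.+ j ∸ 1) ∸ i ≡ j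
  range = trans (cong (_∸ i) (ℕ.suc-pred (i ℕ.+ j))) (ℕ.m+n∸m≡n i j)

  summand≡ : ∀ m → m ℕ.< j → ι (s C (i ℕ.+ m)) * X ^ (j ∸ 1 ∸ m) * 1ℚ ^ (i ℕ.+ m) ≡ ι (h (i ℕ.+ m))
  summand≡ m (s≤s {n = j′} m≤j′) = trans (cong (ι (s C (i ℕ.+ m)) * X ^ (j′ ∸ m) *_) (1^ (i ℕ.+ m)))
    (trans (ℚ.*-identityʳ _) (sym (trans (ι-* (s C (i ℕ.+ m)) _)
      (cong (ι (s C (i ℕ.+ m)) *_)
        (trans (cong (λ d → ι ((p ∸ 1) ℕ.^ d)) exponent) (ι-^ (p ∸ 1) (j′ ∸ m)))))))
    where
    exponent : i ℕ.+ suc j′ ∸ 1 ∸ (i ℕ.+ m) ≡ j′ ∸ m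
    exponent = trans (cong (λ k → k ∸ 1 ∸ (i ℕ.+ m)) (ℕ.+-suc i j′)) (ℕ.[m+n]∸[m+o]≡n∸o i j′ m)

ratio : (s k i p : ℕ) → .{{ℕ.NonTrivial p}} → ℚ
ratio s k i p = 1ℚ - _/_ (ℤ.+ binomSum s k i p) (binomSum s k 0 p) {{binomSum₀≢0 s k p}}

-- Scaled by p, both densities are given by `cdf-closed` at (p - 1, 1), so their quotient is X^j * T
-- s i / T s k. By `binomSum-split` this equals (b₀ - bᵢ) / b₀, the factor of `f` at p. The
-- denominators are multiplied out and cancelled at the end.
localDensity-ratio : ∀ s i j p → .{{_ : ℕ.NonTrivial p}} → .{{ℕ.NonZero (i ℕ.+ j)}} →
  localDensity s p i ≡ localDensity s p (i ℕ.+ j) * ratio s (i ℕ.+ j) i p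
localDensity-ratio s i j p@(suc (suc p′)) = ι-cancel b₀ {{b₀≢0}} (^-cancelˡ (ι p) s (^-cancelˡ X k (begin
  X ^ k * (ι p ^ s * (ι b₀ * localDensity s p i))
    ≡⟨ cong₂ (λ z b → z * (ι p ^ s * (b * localDensity s p i))) (^-distrib-+ X i j) ιb₀≡T ⟩
  X ^ i * X ^ j * (ι p ^ s * (T s k * localDensity s p i))
    ≡⟨ solve 5 (λ a b c d e → a :* b :* (c :* (d :* e)) := b :* d :* (a :* (c :* e))) refl
         (X ^ i) (X ^ j) (ι p ^ s) (T s k) (localDensity s p i) ⟩
  X ^ j * T s k * (X ^ i * (ι p ^ s * localDensity s p i))
    ≡⟨ cong (X ^ j * T s k *_) (closed i) ⟩
  X ^ j * T s k * (X ^ suc s * T s i)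
    ≡⟨ solve 4 (λ a b c d → a :* b :* (c :* d) := c :* b :* (a :* d)) refl
         (X ^ j) (T s k) (X ^ suc s) (T s i) ⟩
  X ^ suc s * T s k * (X ^ j * T s i)
    ≡⟨ cong₂ _*_ (sym (closed k)) (sym ratio≡) ⟩
  X ^ k * (ι p ^ s * localDensity s p k) * (ι b₀ * ratio s k i p)
    ≡⟨ solve 5 (λ a b c d e → a :* (b :* c) :* (d :* e) := a :* (b :* (d :* (c :* e)))) refl
         (X ^ k) (ι p ^ s) (localDensity s p k) (ι b₀) (ratio s k i p) ⟩
  X ^ k * (ι p ^ s * (ι b₀ * (localDensity s p k * ratio s k i p))) ∎)))
  where
  open ≡-Reasoning
  open Binomial (ι (p ∸ 1)) 1ℚ
  X  = ι (p ∸ 1)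
  k  = i ℕ.+ j
  b₀ = binomSum s k 0 p
  bᵢ = binomSum s k i p
  b₀≢0 = binomSum₀≢0 s k p

  instance
    X≢0 : NonZero X
    X≢0 = ℚ.pos⇒nonZero X {{ℚ.normalize-pos (suc p′) 1}}

    ιp≢0 : NonZero (ι p)
    ιp≢0 = ℚ.pos⇒nonZero (ι p) {{ℚ.normalize-pos p 1}}

  ιb₀≡T : ι b₀ ≡ T s k
  ιb₀≡T = sym (trans (binomSum-split s p 0 k)
    (solve 2 (λ z a → z :* con 0ℚ :+ a := a) refl (X ^ k) (ι b₀)))

  scaled : ∀ t → ι p ^ s * localDensity s p t ≡ cdf s t
  scaled t = trans (sym (binomialCDF-homogeneous (ι p) (1ℚ - ρ p) (ρ p) s t))
    (cong₂ (λ x y → binomialCDF x y s t) p*q (ι*ρ≡1 p))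
    where
    p*q : ι p * (1ℚ - ρ p) ≡ X
    p*q = begin
      ι p * (1ℚ - ρ p)        ≡⟨ solve 2 (λ i r → i :* (con 1ℚ :- r) := i :- i :* r) refl (ι p) (ρ p) ⟩
      ι p - ι p * ρ p         ≡⟨ cong₂ _-_ (ι-suc (suc p′)) (ι*ρ≡1 p) ⟩
      (1ℚ + X) - 1ℚ           ≡⟨ solve 1 (λ x → (con 1ℚ :+ x) :- con 1ℚ := x) refl X ⟩
      X                       ∎

  closed : ∀ t → X ^ t * (ι p ^ s * localDensity s p t) ≡ X ^ suc s * T s t
  closed t = trans (cong (X ^ t *_) (scaled t)) (cdf-closed s t)

  ratio≡ : ι b₀ * ratio s k i p ≡ X ^ j * T s i
  ratio≡ = begin
    ι b₀ * ratio s k i p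
      ≡⟨ cong (λ r → ι b₀ * (1ℚ - r)) (/≡ι*ρ bᵢ b₀ {{b₀≢0}}) ⟩
    ι b₀ * (1ℚ - ι bᵢ * ρ b₀)
      ≡⟨ solve 3 (λ b c r → b :* (con 1ℚ :- c :* r) := b :- c :* (b :* r)) refl (ι b₀) (ι bᵢ) (ρ b₀) ⟩
    ι b₀ - ι bᵢ * (ι b₀ * ρ b₀)
      ≡⟨ cong₂ (λ a c → a - ι bᵢ * c) (trans ιb₀≡T (binomSum-split s p i j)) (ι*ρ≡1 b₀ {{b₀≢0}}) ⟩
    (X ^ j * T s i + ι bᵢ) - ι bᵢ * 1ℚ
      ≡⟨ solve 2 (λ a b → (a :+ b) :- b :* con 1ℚ := a) refl (X ^ j * T s i) (ι bᵢ) ⟩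
    X ^ j * T s i ∎

-- Euler products and coprimality conditions

productℚ-++ : ∀ xs ys → productℚ (xs ++ ys) ≡ productℚ xs * productℚ ys
productℚ-++ []       ys = sym (ℚ.*-identityˡ (productℚ ys))
productℚ-++ (x ∷ xs) ys = trans (cong (x *_) (productℚ-++ xs ys)) (sym (ℚ.*-assoc x _ _))

productℚ-upTo : ∀ h n → productℚ (map h (upTo n)) ≡ ∏ h n
productℚ-upTo h zero    = refl
productℚ-upTo h (suc n) = begin
  productℚ (map h (upTo (suc n)))             ≡⟨ cong (λ l → productℚ (map h l)) (sym (upTo-∷ʳ n)) ⟩
  productℚ (map h (upTo n ++ n ∷ []))         ≡⟨ cong productℚ (map-++ h (upTo n) (n ∷ [])) ⟩
  productℚ (map h (upTo n) ++ h n ∷ [])       ≡⟨ productℚ-++ (map h (upTo n)) (h n ∷ []) ⟩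
  productℚ (map h (upTo n)) * (h n * 1ℚ)      ≡⟨ cong₂ _*_ (productℚ-upTo h n) (ℚ.*-identityʳ (h n)) ⟩
  ∏ h n * h n                                 ∎
  where open ≡-Reasoning

productℚ-filter : {P : Pred ℕ 0ℓ} (P? : Decidable P) (h : ℕ → ℚ) → ∀ xs →
  productℚ (map h (filter P? xs)) ≡ productℚ (map (λ p → ifDec (P? p) (h p)) xs)
productℚ-filter P? h []       = refl
productℚ-filter P? h (x ∷ xs) with P? x
... | yes _ = cong (h x *_) (productℚ-filter P? h xs)
... | no _  = trans (productℚ-filter P? h xs) (sym (ℚ.*-identityˡ _))

productℚ-tabulate-1 : ∀ {n} (φ : Fin n → ℚ) → (∀ i → φ i ≡ 1ℚ) → productℚ (tabulate φ) ≡ 1ℚ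
productℚ-tabulate-1 {zero}  φ φ≡1 = refl
productℚ-tabulate-1 {suc n} φ φ≡1 =
  cong₂ _*_ (φ≡1 zero) (productℚ-tabulate-1 (φ ∘ suc) (φ≡1 ∘ suc))

productℚ-tabulate-single : ∀ {n} (φ : Fin n → ℚ) i → (∀ j → j ≢ i → φ j ≡ 1ℚ) →
  productℚ (tabulate φ) ≡ φ i
productℚ-tabulate-single φ zero    others = trans
  (cong (φ zero *_) (productℚ-tabulate-1 (φ ∘ suc) λ j → others (suc j) λ ()))
  (ℚ.*-identityʳ (φ zero))
productℚ-tabulate-single φ (suc i) others = trans
  (cong₂ _*_ (others zero λ ())
    (productℚ-tabulate-single (φ ∘ suc) i λ j j≢i → others (suc j) λ { refl → j≢i refl }))
  (ℚ.*-identityˡ (φ (suc i)))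

∏-productℚ : ∀ {n} (w : Fin n → ℕ → ℚ) N →
  ∏ (λ p → productℚ (tabulate (λ i → w i p))) N ≡ productℚ (tabulate (λ i → ∏ (w i) N))
∏-productℚ {zero}  w N = ∏-1 N
∏-productℚ {suc n} w N = trans (∏-* (w zero) (λ p → productℚ (tabulate (λ i → w (suc i) p))) N)
  (cong (∏ (w zero) N *_) (∏-productℚ (w ∘ suc) N))

∏-extend : ∀ h m j → (∀ p → m ℕ.≤ p → h p ≡ 1ℚ) → ∏ h m ≡ ∏ h (m ℕ.+ j)
∏-extend h m zero    h≡1 = cong (∏ h) (sym (ℕ.+-identityʳ m))
∏-extend h m (suc j) h≡1 = begin
  ∏ h m                                 ≡⟨ ∏-extend h m j h≡1 ⟩
  ∏ h (m ℕ.+ j)                         ≡⟨ sym (ℚ.*-identityʳ _) ⟩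
  ∏ h (m ℕ.+ j) * 1ℚ                    ≡⟨ cong (∏ h (m ℕ.+ j) *_) (sym (h≡1 (m ℕ.+ j) (ℕ.m≤m+n m j))) ⟩
  ∏ h (m ℕ.+ j) * h (m ℕ.+ j)           ≡⟨ cong (∏ h) (sym (ℕ.+-suc m j)) ⟩
  ∏ h (m ℕ.+ suc j)                     ∎
  where open ≡-Reasoning

-- Prime divisors of the gcd of several entries

no-prime-divisor : ∀ d → (∀ p → Prime p → p ∤ d) → d ≡ 1
no-prime-divisor zero      ∤d = contradiction (2 ∣0) (∤d 2 prime[2])
no-prime-divisor d@(suc _) ∤d with factorise d
... | record { factors = []     ; isFactorisation = eq } = eq
... | record { factors = p ∷ ps ; isFactorisation = eq ; factorsPrime = pr ∷ _ } =
  contradiction (subst (p ∣_) (sym eq) (m∣m*n _)) (∤d p pr)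

prime∤1 : ∀ {p} → Prime p → p ∤ 1
prime∤1 pr p∣1 = ¬prime[1] (subst Prime (∣1⇒≡1 p∣1) pr)

∣gcdOver⇒card≤hits : ∀ p (I : Subset s) as → p ∣ gcdOver I as → card I ℕ.≤ hits p as
∣gcdOver⇒card≤hits p []            []       _   = z≤n
∣gcdOver⇒card≤hits p (outside ∷ I) (a ∷ as) p∣g =
  ℕ.≤-trans (∣gcdOver⇒card≤hits p I as p∣g) (ℕ.m≤n+m (hits p as) [ p ∣ a ])
∣gcdOver⇒card≤hits p (inside ∷ I)  (a ∷ as) p∣g = subst (λ b → suc (card I) ℕ.≤ b ℕ.+ hits p as)
  (sym (bit-yes (p ∣? a) (∣-trans p∣g (gcd[m,n]∣m a (gcdOver I as)))))
  (s≤s (∣gcdOver⇒card≤hits p I as (∣-trans p∣g (gcd[m,n]∣n a (gcdOver I as)))))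

-- I picks the first i entries that p divides. The recursion may start from the empty gcd, since p
-- divides 0.
≤hits⇒∣gcdOver : ∀ p i (as : Vec ℕ s) → i ℕ.≤ hits p as →
  ∃[ I ] (card I ≡ i × p ∣ gcdOver I as)
≤hits⇒∣gcdOver p zero []       _ = [] , refl , p ∣0
≤hits⇒∣gcdOver p i    (a ∷ as) i≤ with p ∣? a
≤hits⇒∣gcdOver p i (a ∷ as) i≤ | no _ with ≤hits⇒∣gcdOver p i as i≤
... | I , card≡i , p∣g = outside ∷ I , card≡i , p∣g
≤hits⇒∣gcdOver p zero (a ∷ as) i≤ | yes _ with ≤hits⇒∣gcdOver p zero as z≤n
... | I , card≡i , p∣g = outside ∷ I , card≡i , p∣g
≤hits⇒∣gcdOver p (suc i) (a ∷ as) (s≤s i≤) | yes p∣a with ≤hits⇒∣gcdOver p i as i≤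
... | I , card≡i , p∣g = inside ∷ I , cong suc card≡i , gcd-greatest p∣a p∣g

wiseCoprime⇒hits< : ∀ k (as : Vec ℕ s) → WiseCoprime k as → ∀ p → Prime p → hits p as ℕ.< k
wiseCoprime⇒hits< k as wc p pr = ℕ.≰⇒> λ k≤hits →
  let I , card≡k , p∣g = ≤hits⇒∣gcdOver p k as k≤hits
  in prime∤1 pr (subst (p ∣_) (wc I card≡k) p∣g)

hits<⇒wiseCoprime : ∀ k (as : Vec ℕ s) → (∀ p → Prime p → hits p as ℕ.< k) → WiseCoprime k as
hits<⇒wiseCoprime k as hits< I card≡k = no-prime-divisor (gcdOver I as) λ p pr p∣g →
  ℕ.<⇒≱ (hits< p pr) (subst (ℕ._≤ hits p as) card≡k (∣gcdOver⇒card≤hits p I as p∣g))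

wiseCoprimeTo⇒hits< : ∀ i u (as : Vec ℕ s) → WiseCoprimeTo i u as →
  ∀ p → Prime p → p ∣ u → hits p as ℕ.< i
wiseCoprimeTo⇒hits< i u as wc p pr p∣u = ℕ.≰⇒> λ i≤hits →
  let I , card≡i , p∣g = ≤hits⇒∣gcdOver p i as i≤hits
  in ¬prime[1] (subst Prime (wc I card≡i (p∣g , p∣u)) pr)

hits<⇒wiseCoprimeTo : ∀ i u (as : Vec ℕ s) → (∀ p → Prime p → p ∣ u → hits p as ℕ.< i) →
  WiseCoprimeTo i u as
hits<⇒wiseCoprimeTo i u as hits< I card≡i {d} (d∣g , d∣u) = no-prime-divisor d λ p pr p∣d →
  ℕ.<⇒≱ (hits< p pr (∣-trans p∣d d∣u))
    (subst (ℕ._≤ hits p as) card≡i (∣gcdOver⇒card≤hits p I as (∣-trans p∣d d∣g)))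

bounded-above : ∀ {n} (u : Fin n → ℕ) → ∃[ y ] (∀ i → u i ℕ.≤ y)
bounded-above {zero}  u = 0 , λ ()
bounded-above {suc n} u with bounded-above (u ∘ suc)
... | y , u≤y = u zero ℕ.⊔ y , λ
  { zero    → ℕ.m≤m⊔n (u zero) y
  ; (suc i) → ℕ.≤-trans (u≤y i) (ℕ.m≤n⊔m (u zero) y) }

atPrime-factorA : ∀ s t {p} (d : Dec (Prime p)) →
  atPrime (factorA s (suc t)) p d ≡ ifDec d (localDensity s p (suc t))
atPrime-factorA s t {p} (yes pr) = factorA≡localDensity s t p {{prime⇒nonTrivial pr}}
atPrime-factorA s t (no _)       = refl

density≡partialA : ∀ s t y → density s (suc y) (λ _ → suc t) ≡ partialA s (suc t) y
density≡partialA s t y = sym (trans (productℚ-upTo _ (suc y))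
  (∏-cong (suc y) λ p _ → atPrime-factorA s t (prime? p)))

localDensity-ratio-≤ : ∀ s {i k} p → .{{_ : ℕ.NonTrivial p}} → .{{ℕ.NonZero k}} → i ℕ.≤ k →
  localDensity s p i ≡ localDensity s p k * ratio s k i p
localDensity-ratio-≤ s {i} p i≤k with ℕ.m≤n⇒∃[o]m+o≡n i≤k
... | j , refl = localDensity-ratio s i j p

ifDec-yes : ∀ {P : Set} (d : Dec P) {q} → P → ifDec d q ≡ q
ifDec-yes (yes _) _ = refl
ifDec-yes (no ¬p) p = contradiction p ¬p

ifDec-no : ∀ {P : Set} (d : Dec P) {q} → ¬ P → ifDec d q ≡ 1ℚ
ifDec-no (yes p) ¬p = contradiction p ¬p
ifDec-no (no _)  _  = refl

ifDec-1 : ∀ {P : Set} (d : Dec P) → ifDec d 1ℚ ≡ 1ℚ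
ifDec-1 (yes _) = refl
ifDec-1 (no _)  = refl

atPrime-yes : ∀ (g : (p : ℕ) → .{{ℕ.NonTrivial p}} → ℚ) {p} (d : Dec (Prime p)) (pr : Prime p) →
  atPrime g p d ≡ g p {{prime⇒nonTrivial pr}}
atPrime-yes g (yes _)  _  = refl
atPrime-yes g (no ¬pr) pr = contradiction pr ¬pr

atPrime-no : ∀ (g : (p : ℕ) → .{{ℕ.NonTrivial p}} → ℚ) {p} (d : Dec (Prime p)) → ¬ Prime p →
  atPrime g p d ≡ 1ℚ
atPrime-no g (yes pr) ¬pr = contradiction pr ¬pr
atPrime-no g (no _)   _   = refl

-- The thresholds prescribed by u and the resulting density

module Threshold (s t : ℕ) (u : Fin t → ℕ)
  (u≢0 : ∀ i → ℕ.NonZero (u i)) (coprime : ∀ i j → i ≢ j → gcd (u i) (u j) ≡ 1) where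

  k : ℕ
  k = suc t

  -- The decision is an argument so that `localDensity-choose` can split on it directly.
  choose : ∀ {p} → Dec (∃[ i ] p ∣ u i) → ℕ
  choose (yes (i , _)) = suc (toℕ i)
  choose (no _)        = k

  threshold : ℕ → ℕ
  threshold p = choose (any? (λ i → p ∣? u i))

  1≤threshold : ∀ p → 1 ℕ.≤ threshold p
  1≤threshold p with any? (λ i → p ∣? u i)
  ... | yes _ = s≤s z≤n
  ... | no _  = s≤s z≤n

  threshold≤k : ∀ p → threshold p ℕ.≤ k
  threshold≤k p with any? (λ i → p ∣? u i)
  ... | yes (i , _) = ℕ.m≤n⇒m≤1+n (toℕ<n i)
  ... | no _        = ℕ.≤-refl

  y₀ : ℕ
  y₀ = proj₁ (bounded-above u)

  u≤y₀ : ∀ i → u i ℕ.≤ y₀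
  u≤y₀ = proj₂ (bounded-above u)

  2≤threshold : 2 ℕ.≤ k → ∀ p → y₀ ℕ.< p → 2 ℕ.≤ threshold p
  2≤threshold 2≤k p y₀<p with any? (λ i → p ∣? u i)
  ... | yes (i , p∣uᵢ) = contradiction p∣uᵢ (>⇒∤ {{u≢0 i}} (ℕ.≤-<-trans (u≤y₀ i) y₀<p))
  ... | no _           = 2≤k

  index-unique : ∀ {p i j} → Prime p → p ∣ u i → p ∣ u j → i ≡ j
  index-unique {p} {i} {j} pr p∣uᵢ p∣uⱼ with i ≟ᶠ j
  ... | yes i≡j = i≡j
  ... | no i≢j  = contradiction (subst (p ∣_) (coprime i j i≢j) (gcd-greatest p∣uᵢ p∣uⱼ)) (prime∤1 pr)

  threshold-∣ : ∀ {p i} → Prime p → p ∣ u i → threshold p ≡ suc (toℕ i)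
  threshold-∣ {p} {i} pr p∣uᵢ with any? (λ i → p ∣? u i)
  ... | yes (j , p∣uⱼ) = cong (suc ∘ toℕ) (index-unique pr p∣uⱼ p∣uᵢ)
  ... | no ∄           = contradiction (i , p∣uᵢ) ∄

  admissible⇒hits< : ∀ (as : Vec ℕ s) → Admissible k u as →
    ∀ p → Prime p → hits p as ℕ.< threshold p
  admissible⇒hits< as (wc , wcTo) p pr with any? (λ i → p ∣? u i)
  ... | yes (i , p∣uᵢ) = wiseCoprimeTo⇒hits< (suc (toℕ i)) (u i) as (wcTo i) p pr p∣uᵢ
  ... | no _           = wiseCoprime⇒hits< k as wc p pr

  -- No threshold exceeds k, which yields the k-wise condition. By coprimality the threshold at a
  -- prime dividing u i is the one belonging to this i.
  hits<⇒admissible : ∀ (as : Vec ℕ s) → (∀ p → Prime p → hits p as ℕ.< threshold p) →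
    Admissible k u as
  hits<⇒admissible as hits< =
    hits<⇒wiseCoprime k as (λ p pr → ℕ.<-≤-trans (hits< p pr) (threshold≤k p)) ,
    λ i → hits<⇒wiseCoprimeTo (suc (toℕ i)) (u i) as λ p pr p∣uᵢ →
      subst (hits p as ℕ.<_) (threshold-∣ pr p∣uᵢ) (hits< p pr)

  -- The contribution of p to the factor of `∏f` at i, extended by 1 to all p so that these products
  -- and that of A share one range.
  correction : Fin t → ℕ → ℚ
  correction i p = ifDec (p ∣? u i) (atPrime (ratio s k (suc (toℕ i))) p (prime? p))

  correction-∤ : ∀ i p → p ∤ u i → correction i p ≡ 1ℚ
  correction-∤ i p = ifDec-no (p ∣? u i)

  correction-nonprime : ∀ i p → ¬ Prime p → correction i p ≡ 1ℚ
  correction-nonprime i p ¬pr = trans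
    (cong (ifDec (p ∣? u i)) (atPrime-no (ratio s k (suc (toℕ i))) (prime? p) ¬pr))
    (ifDec-1 (p ∣? u i))

  correction-∣ : ∀ {i p} (pr : Prime p) → p ∣ u i →
    correction i p ≡ ratio s k (suc (toℕ i)) p {{prime⇒nonTrivial pr}}
  correction-∣ {i} {p} pr p∣uᵢ = trans (ifDec-yes (p ∣? u i) p∣uᵢ)
    (atPrime-yes (ratio s k (suc (toℕ i))) (prime? p) pr)

  -- At most one of the corrections at p differs from 1, because p divides at most one u i.
  localDensity-choose : ∀ {p} → Prime p → (d : Dec (∃[ i ] p ∣ u i)) →
    localDensity s p (choose d) ≡ localDensity s p k * productℚ (tabulate (λ i → correction i p))
  localDensity-choose {p} pr (no ∄) = sym (trans
    (cong (localDensity s p k *_) (productℚ-tabulate-1 (λ i → correction i p) λ i →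
      correction-∤ i p λ p∣uᵢ → ∄ (i , p∣uᵢ)))
    (ℚ.*-identityʳ (localDensity s p k)))
  localDensity-choose {p} pr (yes (i , p∣uᵢ)) = trans
    (localDensity-ratio-≤ s p {{prime⇒nonTrivial pr}} (ℕ.m≤n⇒m≤1+n (toℕ<n i)))
    (cong (localDensity s p k *_) (sym (trans
      (productℚ-tabulate-single (λ i → correction i p) i λ j j≢i →
        correction-∤ j p λ p∣uⱼ → j≢i (index-unique pr p∣uⱼ p∣uᵢ))
      (correction-∣ pr p∣uᵢ))))

  density-factor : ∀ p → ifDec (prime? p) (localDensity s p (threshold p)) ≡
    ifDec (prime? p) (localDensity s p k) * productℚ (tabulate (λ i → correction i p))
  density-factor p = go (prime? p)
    where
    go : (d : Dec (Prime p)) → ifDec d (localDensity s p (threshold p)) ≡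
      ifDec d (localDensity s p k) * productℚ (tabulate (λ i → correction i p))
    go (yes pr) = localDensity-choose pr (any? (λ i → p ∣? u i))
    go (no ¬pr) = sym (cong (1ℚ *_) (productℚ-tabulate-1 (λ i → correction i p) λ i →
      correction-nonprime i p ¬pr))

  ∏-correction : ∀ i y → u i ℕ.≤ y → ∏ (correction i) (suc y) ≡ f s k (suc (toℕ i)) (u i)
  ∏-correction i y uᵢ≤y = sym (begin
    f s k (suc (toℕ i)) (u i)
      ≡⟨ productℚ-filter (_∣? u i) (λ p → atPrime (ratio s k (suc (toℕ i))) p (prime? p)) (upTo (suc (u i))) ⟩
    productℚ (map (correction i) (upTo (suc (u i))))
      ≡⟨ productℚ-upTo (correction i) (suc (u i)) ⟩
    ∏ (correction i) (suc (u i))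
      ≡⟨ ∏-extend (correction i) (suc (u i)) (y ∸ u i)
           (λ p uᵢ<p → correction-∤ i p (>⇒∤ {{u≢0 i}} uᵢ<p)) ⟩
    ∏ (correction i) (suc (u i) ℕ.+ (y ∸ u i))
      ≡⟨ cong (∏ (correction i) ∘ suc) (ℕ.m+[n∸m]≡n uᵢ≤y) ⟩
    ∏ (correction i) (suc y) ∎)
    where open ≡-Reasoning

  -- Once y is at least every u i, the products in `f` are complete, so this is an exact identity
  -- and not merely an asymptotic one.
  density-threshold : ∀ y → y₀ ℕ.≤ y → density s (suc y) threshold ≡ partialA s k y * ∏f s k u
  density-threshold y y₀≤y = begin
    density s (suc y) threshold
      ≡⟨ ∏-cong (suc y) (λ p _ → density-factor p) ⟩
    ∏ (λ p → ifDec (prime? p) (localDensity s p k) * productℚ (tabulate (λ i → correction i p))) (suc y)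
      ≡⟨ ∏-* _ _ (suc y) ⟩
    density s (suc y) (λ _ → k) * ∏ (λ p → productℚ (tabulate (λ i → correction i p))) (suc y)
      ≡⟨ cong₂ _*_ (density≡partialA s t y) (trans (∏-productℚ correction (suc y))
           (cong productℚ (tabulate-cong λ i → ∏-correction i y (ℕ.≤-trans (u≤y₀ i) y₀≤y)))) ⟩
    partialA s k y * ∏f s k u ∎
    where open ≡-Reasoning

-- Convergence of the proportions

proportions : {P : Pred (Vec ℕ s) 0ℓ} → Decidable P → ℕ → ℚ
proportions {s} P? n = proportion s (count P? (suc n)) (suc n)

sandwich-limit : {P : Pred (Vec ℕ s) 0ℓ} (P? : Decidable P) (τ : ℕ → ℕ) (y₀ : ℕ) →
  (∀ p → 1 ℕ.≤ τ p) → (∀ p → y₀ ℕ.< p → 2 ℕ.≤ τ p) →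
  (∀ as → P as → ∀ p → Prime p → hits p as ℕ.< τ p) →
  (∀ as → (∀ p → Prime p → hits p as ℕ.< τ p) → P as) →
  (d : ℕ → ℚ) → (∀ y → y₀ ℕ.≤ y → density s (suc y) τ ≡ d y) →
  IteratedLimit (proportions P?) d
sandwich-limit {s} P? τ y₀ τ≥1 τ≥2 sound complete d density≡d =
  estimate⇒iteratedLimit (s C 2) (λ y → s ℕ.* 2 ℕ.^ suc y) y₀ (proportions P?) d λ y y₀≤y n →
    subst (λ e → ∣ proportions P? n - e ∣ ≤ ι (s C 2) * ρ y + ι (s ℕ.* 2 ℕ.^ suc y) * ρ (suc n))
      (density≡d y y₀≤y) (proportion-estimate y y₀≤y (suc n))
  where open Sandwich P? τ y₀ τ≥1 τ≥2 sound complete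

corollary2 :
    (s k : ℕ) → 1 ℕ.≤ s → 2 ℕ.≤ k →
    ∃[ A ]
      ( (partialA s k ⟶ A)
      × ((u : Fin (k ∸ 1) → ℕ) →
         (∀ i → ℕ.NonZero (u i)) →
         (∀ i j → i ≢ j → gcd (u i) (u j) ≡ 1) →
         HasProbability {s} (admissible? k u) (A *ᴿ fromℚ (∏f s k u))
         × ((λ n → proportion s (Q s k u (suc n)) (suc n)) ⟶ A *ᴿ fromℚ (∏f s k u)))
      × HasProbability {s} (wiseCoprime? k) A )
corollary2 s k@(suc t) _ 2≤k = A , seq⟶ A
  -- `Q` unfolds to the `count` inside `HasProbability`, so one proof gives both conjuncts.
  , (λ u u≢0 coprime → let lim = admissible-limit u u≢0 coprime in lim , lim)
  , iteratedLimit⇒⟶ (proportions {s} (wiseCoprime? k)) A wiseCoprime-limit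
  where
  wiseCoprime-limit : IteratedLimit (proportions {s} (wiseCoprime? k)) (partialA s k)
  -- The constant threshold k is treated directly instead of by way of u = 1, since A itself is
  -- built from this limit.
  wiseCoprime-limit = sandwich-limit {s} (wiseCoprime? k) (λ _ → k) 0 (λ _ → s≤s z≤n) (λ _ _ → 2≤k)
    (wiseCoprime⇒hits< k) (hits<⇒wiseCoprime k) (partialA s k) (λ y _ → density≡partialA s t y)

  A : ℝ
  A = mkℝ (partialA s k)
    (iteratedLimit⇒cauchy (proportions {s} (wiseCoprime? k)) (partialA s k) wiseCoprime-limit)

  admissible-limit : (u : Fin t → ℕ) → (∀ i → ℕ.NonZero (u i)) →
    (∀ i j → i ≢ j → gcd (u i) (u j) ≡ 1) →
    HasProbability {s} (admissible? k u) (A *ᴿ fromℚ (∏f s k u))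
  admissible-limit u u≢0 coprime = iteratedLimit⇒⟶
    (proportions {s} (admissible? k u)) (A *ᴿ fromℚ (∏f s k u))
    -- Multiplication of reals is termwise, so the sequence of `A *ᴿ fromℚ (∏f s k u)` is by
    -- definition the one supplied here.
    (sandwich-limit {s} (admissible? k u) threshold y₀ 1≤threshold (2≤threshold 2≤k)
      admissible⇒hits< hits<⇒admissible (λ y → partialA s k y * ∏f s k u) density-threshold)
    where open Threshold s t u u≢0 coprime hiding (k)
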